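{- Let $m\ge1$, $\boldsymbol\gamma=(\gamma_1,\ldots,\gamma_m)\in\mathbb{N}^m$, $\boldsymbol f=(f_1,\ldots,f_{m+1})$ a tuple of arithmetic functions and $\xi:\mathbb{N}^m\to\mathbb{C}$. For every $n_1\in\mathbb{N}$ and all $n_2,\ldots,n_{m+1}\in\mathbb{N}$, \[ S^{\boldsymbol\gamma,\xi}_{\boldsymbol f}(n_1,\ldots,n_{m+1})=\sum_{l_2,\ldots,l_{m+1}=1}^{n_1}a_{n_1}(l_2,\ldots,l_{m+1})\,e(n_1,n_2l_2)\cdots e(n_1,n_{m+1}l_{m+1}) =\sum_{d_2,\ldots,d_{m+1}\mid n_1}\alpha_{n_1}(d_2,\ldots,d_{m+1})\,c(d_2,n_2)\cdots c(d_{m+1},n_{m+1}), \] where \[ a_{n_1}(l_2,\ldots,l_{m+1})=n_1^{ -m}\,S^{{}^t\xi^{\boldsymbol\gamma}_{n_1}}_{{}^t\widetilde{\boldsymbol f}}(n_1,l_{m+1},\ldots,l_2),\qquad \alpha_{n_1}(d_2,\ldots,d_{m+1})=n_1^{ -m}\,S^{{}^t\xi^{\boldsymbol\gamma}_{n_1}}_{{}^t\widetilde{\boldsymbol f}}\Bigl(n_1,\frac{n_1}{d_{m+1}},\ldots,\frac{n_1}{d_2}\Bigr). \] (These are the unique finite Fourier coefficients of $(n_2,\ldots,n_{m+1})\mapsto S^{\boldsymbol\gamma,\xi}_{\boldsymbol f}(n_1,\ldots,n_{m+1})$.)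
   Context: An arithmetic function is a map $f:\mathbb{N}\to\mathbb{C}$, with $f(x)=0$ for $x\notin\mathbb{N}$. $\delta^x(n):=n^x$. For $\gamma\in\mathbb{N}$, $a_\gamma(n)=1$ if $n$ is a $\gamma$-th power of a positive integer and $0$ otherwise. $e(r,n):=\exp(2\pi\sqrt{ -1}\,n/r)$, and $c(k,n):=\sum_{d\mid\gcd(k,n)}\mu(k/d)\,d$ is the Ramanujan sum ($\mu$ the Möbius function). For $\boldsymbol\gamma\in\mathbb{N}^m$, arithmetic functions $g_1,\ldots,g_{m+1}$ and a weight $\eta:\mathbb{N}^m\to\mathbb{C}$, define \[ S^{\boldsymbol\gamma,\eta}_{g_1,\ldots,g_{m+1}}(n_1,\ldots,n_{m+1}):=\sum_{\substack{(d_1,\ldots,d_m)\in\mathbb{N}^m\\ d_j^{\gamma_j}\mid\gcd(n_1,\ldots,n_{j+1})\ (1\le j\le m)}}\eta(d_1^{\gamma_1},\ldots,d_m^{\gamma_m})\, g_1\Bigl(\frac{n_1}{d_1^{\gamma_1}}\Bigr)g_2\Bigl(\frac{d_1^{\gamma_1}}{d_2^{\gamma_2}}\Bigr)\cdots g_m\Bigl(\frac{d_{m-1}^{\gamma_{m-1}}}{d_m^{\gamma_m}}\Bigr)g_{m+1}\bigl(d_m^{\gamma_m}\bigr), \] and write $S^{\eta}_{g_1,\ldots,g_{m+1}}:=S^{(1,\ldots,1),\eta}_{g_1,\ldots,g_{m+1}}$. For $\boldsymbol f=(f_1,\ldots,f_{m+1})$ set ${}^t\widetilde{\boldsymbol f}:=(\delta^0f_{m+1},\delta^1f_m,\ldots,\delta^mf_1)$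 (products of functions taken pointwise), and for $n\in\mathbb{N}$ set \[ {}^t\xi^{\boldsymbol\gamma}_n(d_1,\ldots,d_m):=\Bigl(\prod_{j=1}^m a_{\gamma_j}\Bigl(\frac{n}{d_{m+1-j}}\Bigr)\Bigr)\,\xi\Bigl(\frac{n}{d_m},\ldots,\frac{n}{d_1}\Bigr) \] (only values with $d_j\mid n$ are used). -}

module Defs where

open import Level using (suc; _⊔_)
open import Algebra.Apartness.Bundles using (HeytingField; HeytingCommutativeRing)
open import Algebra.Bundles using (CommutativeRing; Semiring)
import Algebra.Definitions.RawSemiring as RawSemiringOps
open import Data.Bool.Base using (if_then_else_)
open import Data.Fin.Base using (toℕ; opposite)
open import Data.Integer.Base using (ℤ; +_; -[1+_])
open import Data.List.Base as List using (List; []; _∷_)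
open import Data.List.Relation.Unary.Any using (any?)
open import Data.Nat.Base as ℕ using (ℕ; zero; NonZero)
open import Data.Nat.Divisibility using (_∣_; _∣?_)
open import Data.Nat.GCD using (gcd)
open import Data.Nat.Primality.Factorisation using (factors; factorise)
open import Data.Nat.Properties using (_≟_)
open import Data.List.Relation.Unary.Unique.DecPropositional _≟_ using (unique?)
open import Data.Product.Base using (∃; proj₁)
open import Data.Vec.Base as Vec using (Vec; []; _∷_)
open import Data.Vec.Relation.Binary.Pointwise.Inductive as Pointwise using (Pointwise)
open import Function.Bundles using (_⇔_)
open import Relation.Nullary.Decidable.Core using (does)

module FieldOps {c ℓ₁ ℓ₂} (K : HeytingField c ℓ₁ ℓ₂) where

  open HeytingField K

  commutativeRing : CommutativeRing c ℓ₁
  commutativeRing = HeytingCommutativeRing.commutativeRing heytingCommutativeRing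

  open RawSemiringOps (Semiring.rawSemiring (CommutativeRing.semiring commutativeRing)) public
    using () renaming (_×_ to _×ᶜ_; _^_ to _^ᶜ_)

  fromℕ : ℕ → Carrier
  fromℕ n = n ×ᶜ 1#

  fromℤ : ℤ → Carrier
  fromℤ (+ n)    = fromℕ n
  fromℤ -[1+ n ] = - fromℕ (ℕ.suc n)

-- The standard library has no complex numbers.  This interface lists what is
-- used of ℂ: it is a field of characteristic 0 containing √-1 and a nonzero
-- number π, and exp is a homomorphism from (ℂ, +) to (ℂ, *) with kernel
-- 2π√-1ℤ.  The intended instance is ℂ with its usual π and exp (_#_ being
-- its usual apartness, classically just ≉).  The field is a Heyting field so
-- that equality of complex numbers need not be decidable.
record ComplexExponentialField c ℓ₁ ℓ₂ : Set (suc (c ⊔ ℓ₁ ⊔ ℓ₂)) where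
  field
    heytingField : HeytingField c ℓ₁ ℓ₂

  open HeytingField heytingField public
  open FieldOps heytingField public

  field
    char-0      : ∀ n .{{_ : NonZero n}} → fromℕ n # 0#
    √-1         : Carrier
    √-1*√-1≈-1  : √-1 * √-1 ≈ - 1#
    π           : Carrier
    π#0         : π # 0#
    exp         : Carrier → Carrier
    exp-cong    : ∀ {x y} → x ≈ y → exp x ≈ exp y
    exp-+       : ∀ x y → exp (x + y) ≈ exp x * exp y

  2π√-1 : Carrier
  2π√-1 = fromℕ 2 * π * √-1

  field
    exp-kernel  : ∀ z → exp z ≈ 1# ⇔ ∃ λ k → z ≈ 2π√-1 * fromℤ k

  -- #⇒invertible inverts the difference fromℕ n - 0#.
  1/_ : ∀ n .{{_ : NonZero n}} → Carrier
  1/ n = proj₁ (#⇒invertible (char-0 n))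

-- {1, …, n}
range⁺ : ℕ → List ℕ
range⁺ n = List.map ℕ.suc (List.upTo n)

divisors : ℕ → List ℕ
divisors n = List.filter (_∣? n) (range⁺ n)

tuples : ∀ m → List ℕ → List (Vec ℕ m)
tuples zero      xs = [] ∷ []
tuples (ℕ.suc m) xs = List.cartesianProductWith _∷_ xs (tuples m xs)

-- Only used for divisors y > 0 of x, where it is exact.
infixl 7 _÷_
_÷_ : ℕ → ℕ → ℕ
x ÷ zero        = 0
x ÷ y@(ℕ.suc _) = x ℕ./ y

-- gcds g (n₂ ∷ n₃ ∷ …) = gcd(g,n₂) ∷ gcd(g,n₂,n₃) ∷ …
gcds : ∀ {m} → ℕ → Vec ℕ m → Vec ℕ m
gcds g []       = []
gcds g (n ∷ ns) = gcd g n ∷ gcds (gcd g n) ns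

module Arithmetic {c ℓ₁ ℓ₂} (ℂ : ComplexExponentialField c ℓ₁ ℓ₂) where

  open ComplexExponentialField ℂ public

  -- Arithmetic functions live on the positive integers; the value at 0 is
  -- never consulted.
  ArithmeticFunction : Set c
  ArithmeticFunction = ℕ → Carrier

  -- f evaluated at the rational number x / y (y > 0), which is 0 unless x / y
  -- is an integer.
  _⟨_/_⟩ : ArithmeticFunction → ℕ → ℕ → Carrier
  f ⟨ x / y ⟩ = if does (y ∣? x) then f (x ÷ y) else 0#

  ∑ : ∀ {a} {A : Set a} → List A → (A → Carrier) → Carrier
  ∑ xs f = List.foldr _+_ 0# (List.map f xs)

  ∏ : ∀ {m} → Vec Carrier m → Carrier
  ∏ = Vec.foldr′ _*_ 1#

  δ : ℕ → ArithmeticFunction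
  δ x n = fromℕ (n ℕ.^ x)

  -- For n, γ > 0, a γ-th root of n lies in {1, …, n}.
  powerIndicator : ℕ → ArithmeticFunction
  powerIndicator γ n =
    if does (any? (λ k → k ℕ.^ γ ≟ n) (range⁺ n)) then 1# else 0#

  e : ∀ r .{{_ : NonZero r}} → ℕ → Carrier
  e r n = exp (2π√-1 * fromℕ n * 1/ r)

  -- n is squarefree iff its prime factors, listed with multiplicity, are
  -- pairwise distinct.
  μ : ArithmeticFunction
  μ zero        = 0#
  μ n@(ℕ.suc _) = if does (unique? ps) then (- 1#) ^ᶜ List.length ps else 0#
    where ps = factors (factorise n)

  ramanujan : ℕ → ℕ → Carrier
  ramanujan k n = ∑ (divisors (gcd k n)) λ d → μ (k ÷ d) * fromℕ d

  -- chain (g₁ , … , gₘ₊₁) n₁ (D₁ , … , Dₘ)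
  --   = g₁(n₁/D₁) g₂(D₁/D₂) ⋯ gₘ(Dₘ₋₁/Dₘ) gₘ₊₁(Dₘ)
  chain : ∀ {m} → Vec ArithmeticFunction (ℕ.suc m) → ℕ → Vec ℕ m → Carrier
  chain (g ∷ [])         x []       = g x
  chain (g ∷ gs@(_ ∷ _)) x (D ∷ Ds) = g ⟨ x / D ⟩ * chain gs D Ds

  -- S γ η g n₁ (n₂ , … , nₘ₊₁).  For positive γⱼ and n₁ the divisibility
  -- conditions force 1 ≤ dⱼ ≤ n₁, so the sum ranges over all admissible tuples.
  S : ∀ {m} → Vec ℕ m → (Vec ℕ m → Carrier) →
      Vec ArithmeticFunction (ℕ.suc m) → ℕ → Vec ℕ m → Carrier
  S {m} γ η g n₁ ns = ∑ (List.filter admissible? (tuples m (range⁺ n₁)))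
    λ d → η (powers d) * chain g n₁ (powers d)
    where
    powers : Vec ℕ m → Vec ℕ m
    powers d = Vec.zipWith ℕ._^_ d γ
    admissible? = λ (d : Vec ℕ m) →
      Pointwise.decidable _∣?_ (powers d) (gcds n₁ ns)

  S₁ : ∀ {m} → (Vec ℕ m → Carrier) →
       Vec ArithmeticFunction (ℕ.suc m) → ℕ → Vec ℕ m → Carrier
  S₁ {m} = S (Vec.replicate m 1)

  -- (δ⁰ fₘ₊₁ , δ¹ fₘ , … , δᵐ f₁)
  transposeᶠ : ∀ {m} → Vec ArithmeticFunction (ℕ.suc m) →
               Vec ArithmeticFunction (ℕ.suc m)
  transposeᶠ f = Vec.tabulate λ i n → δ (toℕ i) n * Vec.lookup f (opposite i) n

  transposeʷ : ∀ {m} → Vec ℕ m → (Vec ℕ m → Carrier) → ℕ → Vec ℕ m → Carrier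
  transposeʷ γ ξ n d = ∏ (Vec.zipWith powerIndicator γ q) * ξ q
    where q = Vec.map (n ÷_) (Vec.reverse d)

  fourierCoeff : ∀ {m} → Vec ℕ m → (Vec ℕ m → Carrier) →
                 Vec ArithmeticFunction (ℕ.suc m) →
                 ∀ n₁ .{{_ : NonZero n₁}} → Vec ℕ m → Carrier
  fourierCoeff {m} γ ξ f n₁ ls =
    (1/ n₁) ^ᶜ m * S₁ (transposeʷ γ ξ n₁) (transposeᶠ f) n₁ (Vec.reverse ls)

  ramanujanCoeff : ∀ {m} → Vec ℕ m → (Vec ℕ m → Carrier) →
                   Vec ArithmeticFunction (ℕ.suc m) →
                   ∀ n₁ .{{_ : NonZero n₁}} → Vec ℕ m → Carrier
  ramanujanCoeff {m} γ ξ f n₁ ds =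
    (1/ n₁) ^ᶜ m * S₁ (transposeʷ γ ξ n₁) (transposeᶠ f) n₁
                      (Vec.map (n₁ ÷_) (Vec.reverse ds))

  fourierSum : ∀ {m} n₁ .{{_ : NonZero n₁}} →
               (Vec ℕ m → Carrier) → Vec ℕ m → Carrier
  fourierSum {m} n₁ a ns = ∑ (tuples m (range⁺ n₁))
    λ ls → a ls * ∏ (Vec.zipWith (λ n l → e n₁ (n ℕ.* l)) ns ls)

  ramanujanSum : ∀ {m} → ℕ → (Vec ℕ m → Carrier) → Vec ℕ m → Carrier
  ramanujanSum {m} n₁ α ns = ∑ (tuples m (divisors n₁))
    λ ds → α ds * ∏ (Vec.zipWith ramanujan ds ns)

{-# OPTIONS --safe #-}

-- Summing over the values Dⱼ = dⱼ^γⱼ instead of dⱼ, and using that the chain of g's vanishes unless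
-- Dₘ ∣ ⋯ ∣ D₁ ∣ n₁, turns S into
--   ∑_D W(D) ∏ⱼ [Dⱼ ∣ nⱼ₊₁]
-- with Dⱼ running over the divisors of N = n₁ and W independent of n₂, …, nₘ₊₁.  Replacing D by
-- (N/Dₘ, …, N/D₁) in the sum defining the coefficients reverses the chain, and the factors δ⁰, …, δᵐ
-- telescope to ∏ N/Dⱼ; hence the coefficient at l is
--   ∑_D W(D) ∏ⱼ (1/Dⱼ) [N/Dⱼ ∣ lⱼ₊₁].
-- All sums over tuples are thus tensor powers of sums with a kernel in one variable, and the theorem
-- reduces to identities between kernels:
--   ∑_{l ≤ N} e(N, nl) (1/D) [N/D ∣ l] = [D ∣ n] = ∑_{d ∣ N} c(d, n) (1/D) [N/D ∣ N/d],
-- and, for uniqueness, to left inverses of e(N, nl) and c(d, n), namely e(N, -nl)/N and e(N, -nN/d)/N.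

module Submission where

open import Defs
open import Data.Nat.Base using (ℕ; suc; _≤_; NonZero)
open import Data.Nat.Divisibility using (_∣_)
open import Data.Product.Base using (_×_)
open import Data.Vec.Base using (Vec)
open import Data.Vec.Relation.Unary.All using (All)

open import Algebra.Bundles using (CommutativeRing)
import Algebra.Apartness.Properties.HeytingCommutativeRing as HeytingProperties
import Algebra.Properties.CommutativeSemigroup as CommutativeSemigroupProperties
import Algebra.Properties.Ring as RingProperties
import Algebra.Properties.Semiring.Mult as Mult
open import Data.Bool.Base using (if_then_else_)
open import Data.Fin.Base as Fin using (Fin; toℕ; opposite; inject₁)
open import Data.Integer.Base using (+_; -[1+_])
open import Data.List.Base as List using (List; []; _∷_)
import Data.List.Properties as List
open import Data.List.Membership.Propositional using (_∈_; _∉_; lose; find)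
open import Data.List.Membership.Propositional.Properties
  using (∈-map⁺; ∈-map⁻; ∈-upTo⁺; ∈-upTo⁻; ∈-filter⁺; ∈-filter⁻;
         ∈-cartesianProductWith⁺; ∈-cartesianProductWith⁻)
open import Data.List.Membership.Propositional.Properties.WithK using (unique∧set⇒bag)
open import Data.List.Relation.Binary.BagAndSetEquality using (∼bag⇒↭)
open import Data.List.Relation.Binary.Permutation.Propositional using (_↭_; ↭-sym; ↭⇒↭ₛ; ↭⇒↭ₛ′)
open import Data.List.Relation.Binary.Permutation.Propositional.Properties using (map⁺; ↭-length)
import Data.List.Relation.Binary.Permutation.Setoid.Properties as Permutation
import Data.List.Relation.Unary.All as ListAll
open import Data.List.Relation.Unary.Any using (here; there; any?)
open import Data.List.Relation.Unary.Unique.Propositional using (Unique; []; _∷_)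
import Data.List.Relation.Unary.Unique.Propositional.Properties as Unique
open import Data.Nat.Base as ℕ using (_<_)
open import Data.Nat.Coprimality using (coprime-divisor)
open import Data.Nat.Divisibility
  using (_∣?_; _∣0; 1∣_; divides; 0∣⇒≡0; ∣⇒≤; ∣-refl; ∣-reflexive; ∣-trans; m∣m*n; m*n∣⇒n∣;
         ∣m⇒∣m*n; ∣n⇒∣m*n; *-pres-∣; *-monoʳ-∣; *-cancelˡ-∣; *-cancelʳ-∣)
open import Data.Nat.DivMod using (m/n*n≡m; m*n/n≡m)
open import Data.Nat.GCD using (gcd; gcd[m,n]∣m; gcd[m,n]∣n; gcd-greatest)
open import Data.Nat.ListAction using (product)
open import Data.Nat.Primality using (Prime; prime⇒irreducible; prime⇒nonZero; prime⇒nonTrivial)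
open import Data.Nat.Primality.Factorisation
  using (PrimeFactorisation; factors; factorise; factorisationUnique; factorisationHasAllPrimeFactors)
import Data.Nat.Properties as ℕ
open import Data.List.Relation.Unary.Unique.DecPropositional ℕ._≟_ using (unique?)
open import Data.Product.Base using (_,_; proj₁; proj₂; ∃)
open import Data.Sum.Base using (inj₁; inj₂)
open import Data.Unit.Base using (⊤)
open import Data.Vec.Base as Vec using ([]; _∷_; _∷ʳ_)
import Data.Vec.Properties as Vec
open import Data.Vec.Relation.Binary.Pointwise.Inductive as Pointwise using (Pointwise; []; _∷_)
open import Data.Vec.Relation.Unary.All as All using ([]; _∷_)
import Data.Vec.Relation.Unary.All.Properties as All
open import Function.Base using (_∘_; id)
open import Function.Bundles using (Equivalence; mk⇔)
open import Relation.Binary.Definitions using (tri<; tri≈; tri>)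
open import Relation.Binary.PropositionalEquality as ≡ using (_≡_; _≢_; cong; cong₂; subst)
open import Relation.Nullary.Decidable using (Dec; yes; no; does; ¬?; decidable-stable)
open import Relation.Nullary.Negation using (¬_; contradiction)
open import Relation.Unary using (Pred; Decidable)

open PrimeFactorisation using (isFactorisation; factorsPrime)

-- Divisors, ranges and tuples

-- Passing from dⱼ to Dⱼ decouples the variables: on a nonvanishing chain Dⱼ already divides n₁ and
-- all earlier nᵢ, so of the condition Dⱼ ∣ gcd(n₁,...,nⱼ₊₁) only Dⱼ ∣ nⱼ₊₁ remains, and each nⱼ₊₁
-- meets exactly one summation variable. The factor 1/Dⱼ in the coefficients is (1/N)(N/Dⱼ), where
-- 1/N comes from n₁⁻ᵐ and N/Dⱼ from the telescoped powers. Of the two kernel identities, the first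
-- is a geometric sum over the multiples of N/D. The second is Möbius inversion of c(d, n) = ∑
-- μ(d/k) k [k ∣ n] over k ∣ d, which gives ∑ c(d, n) = D [D ∣ n] over d ∣ D. The left inverse for c
-- comes from the classical formula c(e, n) = ∑ e(N, nl) over the l ≤ N with gcd(l, N) = N/e: its
-- Fourier coefficient at the frequency N/d is 1 if d = e and 0 otherwise. Both left inverses sample
-- n in {1,...,N} only, so an expansion known at positive arguments determines its coefficients.

∣-nonZero : ∀ {d n} .{{_ : NonZero n}} → d ∣ n → NonZero d
∣-nonZero {ℕ.zero}  {n} d∣n = contradiction (0∣⇒≡0 d∣n) (ℕ.≢-nonZero⁻¹ n)
∣-nonZero {ℕ.suc _}     _   = _

÷-exact : ∀ {d n} .{{_ : NonZero n}} → d ∣ n → (n ÷ d) ℕ.* d ≡ n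
÷-exact {ℕ.zero} {n} d∣n = contradiction (0∣⇒≡0 d∣n) (ℕ.≢-nonZero⁻¹ n)
÷-exact {ℕ.suc _}    d∣n = m/n*n≡m d∣n

m*n÷n : ∀ m n .{{_ : NonZero n}} → (m ℕ.* n) ÷ n ≡ m
m*n÷n m n@(ℕ.suc _) = m*n/n≡m m n

m*n÷m : ∀ m n .{{_ : NonZero m}} → (m ℕ.* n) ÷ m ≡ n
m*n÷m m n = ≡.trans (cong (_÷ m) (ℕ.*-comm m n)) (m*n÷n n m)

n÷1 : ∀ n → n ÷ 1 ≡ n
n÷1 n = ≡.trans (cong (_÷ 1) (≡.sym (ℕ.*-identityʳ n))) (m*n÷n n 1)

n÷n : ∀ n .{{_ : NonZero n}} → n ÷ n ≡ 1
n÷n n = ≡.trans (cong (_÷ n) (≡.sym (ℕ.*-identityˡ n))) (m*n÷n 1 n)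

module _ {n} .{{_ : NonZero n}} where

  ÷-∣ : ∀ {d} → d ∣ n → n ÷ d ∣ n
  ÷-∣ {d} d∣n = divides d (≡.trans (≡.sym (÷-exact d∣n)) (ℕ.*-comm (n ÷ d) d))

  ÷-nonZero : ∀ {d} → d ∣ n → NonZero (n ÷ d)
  ÷-nonZero d∣n = ∣-nonZero (÷-∣ d∣n)

  ÷-involutive : ∀ {d} → d ∣ n → n ÷ (n ÷ d) ≡ d
  ÷-involutive {d} d∣n = ≡.trans (cong (_÷ (n ÷ d)) (≡.sym (÷-exact d∣n)))
                                 (m*n÷m (n ÷ d) d {{÷-nonZero d∣n}})

  ÷-injective : ∀ {d e} → d ∣ n → e ∣ n → n ÷ d ≡ n ÷ e → d ≡ e
  ÷-injective d∣n e∣n eq =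
    ≡.trans (≡.sym (÷-involutive d∣n)) (≡.trans (cong (n ÷_) eq) (÷-involutive e∣n))

  ÷-antitone : ∀ {d e} → e ∣ n → d ∣ e → n ÷ e ∣ n ÷ d
  ÷-antitone {d} {e} e∣n (divides q ≡.refl) = divides q
    (≡.trans (cong (_÷ d) eq) (m*n÷n _ d {{∣-nonZero (m*n∣⇒n∣ q d e∣n)}}))
    where
    eq : n ≡ (q ℕ.* (n ÷ (q ℕ.* d))) ℕ.* d
    eq = ≡.trans (≡.sym (÷-exact e∣n)) (≡.trans (≡.sym (ℕ.*-assoc (n ÷ (q ℕ.* d)) q d))
           (cong (ℕ._* d) (ℕ.*-comm (n ÷ (q ℕ.* d)) q)))

  -- Complementation is an involution, so the converse of `÷-antitone` is `÷-antitone` applied to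
  -- the complements.
  ÷-antitone⁻¹ : ∀ {d e} → d ∣ n → e ∣ n → n ÷ e ∣ n ÷ d → d ∣ e
  ÷-antitone⁻¹ {d} {e} d∣n e∣n div =
    ≡.subst₂ _∣_ (÷-involutive d∣n) (÷-involutive e∣n) (÷-antitone (÷-∣ d∣n) div)

  -- Follows from n ÷ d = (n ÷ e)(e ÷ d). Ratios of neighbours survive complementation with the
  -- roles exchanged, which is why complementing a chain of divisors reverses it.
  ÷-÷-cancel : ∀ {d e} → e ∣ n → d ∣ e → (n ÷ d) ÷ (n ÷ e) ≡ e ÷ d
  ÷-÷-cancel {d} {e} e∣n d∣e = ≡.trans (cong (_÷ (n ÷ e)) eq) (m*n÷m (n ÷ e) (e ÷ d))
    where
    d∣n = ∣-trans d∣e e∣n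
    instance
      _ = ÷-nonZero e∣n
      _ = ∣-nonZero e∣n
      _ = ∣-nonZero d∣n
    eq : n ÷ d ≡ (n ÷ e) ℕ.* (e ÷ d)
    eq = ℕ.*-cancelʳ-≡ _ _ d (begin
      (n ÷ d) ℕ.* d                 ≡⟨ ÷-exact d∣n ⟩
      n                             ≡⟨ ÷-exact e∣n ⟨
      (n ÷ e) ℕ.* e                 ≡⟨ cong ((n ÷ e) ℕ.*_) (÷-exact d∣e) ⟨
      (n ÷ e) ℕ.* ((e ÷ d) ℕ.* d)   ≡⟨ ℕ.*-assoc (n ÷ e) (e ÷ d) d ⟨
      (n ÷ e) ℕ.* (e ÷ d) ℕ.* d     ∎)
      where open ≡.≡-Reasoning

∈-range⁺ : ∀ {k n} .{{_ : NonZero k}} → k ≤ n → k ∈ range⁺ n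
∈-range⁺ {ℕ.suc k} k<n = ∈-map⁺ ℕ.suc (∈-upTo⁺ k<n)

∈-range⁻ : ∀ {k n} → k ∈ range⁺ n → NonZero k × k ≤ n
∈-range⁻ k∈ with _ , j∈ , ≡.refl ← ∈-map⁻ ℕ.suc k∈ = _ , ∈-upTo⁻ j∈

range⁺-unique : ∀ n → Unique (range⁺ n)
range⁺-unique n = Unique.map⁺ ℕ.suc-injective (Unique.upTo⁺ n)

∈-divisors⁺ : ∀ {d n} .{{_ : NonZero n}} → d ∣ n → d ∈ divisors n
∈-divisors⁺ d∣n = ∈-filter⁺ (_∣? _) (∈-range⁺ {{∣-nonZero d∣n}} (∣⇒≤ d∣n)) d∣n

∈-divisors⁻ : ∀ {d n} → d ∈ divisors n → d ∣ n
∈-divisors⁻ {n = n} d∈ = proj₂ (∈-filter⁻ (_∣? n) {xs = range⁺ n} d∈)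

divisors-unique : ∀ n → Unique (divisors n)
divisors-unique n = Unique.filter⁺ (_∣? n) (range⁺-unique n)

∈-tuples⁺ : ∀ {m xs} {v : Vec ℕ m} → All (_∈ xs) v → v ∈ tuples m xs
∈-tuples⁺ []         = here ≡.refl
∈-tuples⁺ (x∈ ∷ v∈) = ∈-cartesianProductWith⁺ _∷_ x∈ (∈-tuples⁺ v∈)

∈-tuples⁻ : ∀ m {xs} {v : Vec ℕ m} → v ∈ tuples m xs → All (_∈ xs) v
∈-tuples⁻ ℕ.zero    {v = []} _ = []
∈-tuples⁻ (ℕ.suc m) {xs} v∈
  with _ , _ , x∈ , w∈ , ≡.refl ← ∈-cartesianProductWith⁻ _∷_ xs (tuples m xs) v∈
  = x∈ ∷ ∈-tuples⁻ m w∈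

tuples-unique : ∀ m {xs} → Unique xs → Unique (tuples m xs)
tuples-unique ℕ.zero    _  = ListAll.[] ∷ []
tuples-unique (ℕ.suc m) xs! =
  Unique.cartesianProductWith⁺ _∷_ Vec.∷-injective xs! (tuples-unique m xs!)

^-injectiveˡ : ∀ n .{{_ : NonZero n}} {x y} → x ℕ.^ n ≡ y ℕ.^ n → x ≡ y
^-injectiveˡ n {x} {y} eq with ℕ.<-cmp x y
... | tri< x<y _ _ = contradiction eq (ℕ.<⇒≢ (ℕ.^-monoˡ-< n x<y))
... | tri≈ _ x≡y _ = x≡y
... | tri> _ _ y<x = contradiction (≡.sym eq) (ℕ.<⇒≢ (ℕ.^-monoˡ-< n y<x))

m≤m^n : ∀ m n .{{_ : NonZero m}} .{{_ : NonZero n}} → m ≤ m ℕ.^ n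
m≤m^n m n = subst (_≤ m ℕ.^ n) (ℕ.^-identityʳ m) (ℕ.^-monoʳ-≤ m (ℕ.>-nonZero⁻¹ n))

-- Finite sums

-- Injectivity is asked on the members of `xs` only: a map such as `n ÷_` is injective on the
-- divisors of n but not on ℕ.
unique-map⁺ : ∀ {a b} {A : Set a} {B : Set b} (φ : A → B) {xs} → Unique xs →
              (∀ {x y} → x ∈ xs → y ∈ xs → φ x ≡ φ y → x ≡ y) → Unique (List.map φ xs)
unique-map⁺ φ []         inj = []
unique-map⁺ φ {x ∷ xs} (x∉ ∷ xs!) inj =
  ListAll.tabulate (λ y∈ eq → let _ , z∈ , y≡ = ∈-map⁻ φ y∈ in
    ListAll.lookup x∉ z∈ (inj (here ≡.refl) (there z∈) (≡.trans eq y≡)))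
  ∷ unique-map⁺ φ xs! (λ x∈ y∈ → inj (there x∈) (there y∈))

-- Without repetitions, having the same members is already equality as bags, hence a permutation.
-- The changes of summation variable below rest on this.
map-bijection-↭ : ∀ {a b} {A : Set a} {B : Set b} (φ : A → B) {xs ys} → Unique xs → Unique ys →
                  (∀ {x} → x ∈ xs → φ x ∈ ys) →
                  (∀ {x y} → x ∈ xs → y ∈ xs → φ x ≡ φ y → x ≡ y) →
                  (∀ {y} → y ∈ ys → ∃ λ x → x ∈ xs × y ≡ φ x) →
                  List.map φ xs ↭ ys
map-bijection-↭ φ {xs} {ys} xs! ys! φ∈ inj surj =
  ∼bag⇒↭ (unique∧set⇒bag (unique-map⁺ φ xs! inj) ys! (mk⇔ to from))
  where
  to : ∀ {y} → y ∈ List.map φ xs → y ∈ ys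
  to y∈ with _ , x∈ , ≡.refl ← ∈-map⁻ φ y∈ = φ∈ x∈
  from : ∀ {y} → y ∈ ys → y ∈ List.map φ xs
  from y∈ with _ , x∈ , ≡.refl ← surj y∈ = ∈-map⁺ φ x∈

module Sums {c ℓ₁ ℓ₂} (ℂ : ComplexExponentialField c ℓ₁ ℓ₂) where

  open Arithmetic ℂ

  module + = CommutativeSemigroupProperties (CommutativeRing.+-commutativeSemigroup commutativeRing)
  module * = CommutativeSemigroupProperties (CommutativeRing.*-commutativeSemigroup commutativeRing)

  ⟦_⟧ : ∀ {p} {P : Set p} → Dec P → Carrier
  ⟦ P? ⟧ = if does P? then 1# else 0#

  ⟦⟧-yes : ∀ {p} {P : Set p} (P? : Dec P) → P → ⟦ P? ⟧ ≈ 1#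
  ⟦⟧-yes (yes _) p = refl
  ⟦⟧-yes (no ¬p) p = contradiction p ¬p

  ⟦⟧-no : ∀ {p} {P : Set p} (P? : Dec P) → ¬ P → ⟦ P? ⟧ ≈ 0#
  ⟦⟧-no (yes p) ¬p = contradiction p ¬p
  ⟦⟧-no (no _)  ¬p = refl

  ⟦⟧-* : ∀ {p} {P : Set p} (P? : Dec P) {x y} → (P → x ≈ y) → (¬ P → y ≈ 0#) → ⟦ P? ⟧ * x ≈ y
  ⟦⟧-* (yes p) eq eq′ = trans (*-identityˡ _) (eq p)
  ⟦⟧-* (no ¬p) eq eq′ = trans (zeroˡ _) (sym (eq′ ¬p))

  -- Allows rewriting under the assumption P, as required for values of `_÷_` that are meaningful
  -- only under divisibility.
  ⟦⟧-*-cong : ∀ {p} {P : Set p} (P? : Dec P) {x y} → (P → x ≈ y) → ⟦ P? ⟧ * x ≈ ⟦ P? ⟧ * y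
  ⟦⟧-*-cong (yes p) eq = *-congˡ (eq p)
  ⟦⟧-*-cong (no _)  eq = trans (zeroˡ _) (sym (zeroˡ _))

  ⟦⟧-*-yes : ∀ {p} {P : Set p} (P? : Dec P) {x} → P → ⟦ P? ⟧ * x ≈ x
  ⟦⟧-*-yes P? p = trans (*-congʳ (⟦⟧-yes P? p)) (*-identityˡ _)

  ⟦⟧-*-no : ∀ {p} {P : Set p} (P? : Dec P) {x} → ¬ P → ⟦ P? ⟧ * x ≈ 0#
  ⟦⟧-*-no P? ¬p = trans (*-congʳ (⟦⟧-no P? ¬p)) (zeroˡ _)

  ⟦⟧-cong : ∀ {p q} {P : Set p} {Q : Set q} (P? : Dec P) (Q? : Dec Q) →
            (P → Q) → (Q → P) → ⟦ P? ⟧ ≈ ⟦ Q? ⟧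
  ⟦⟧-cong (yes _) (yes _) _  _    = refl
  ⟦⟧-cong (yes p) (no ¬q) to _    = contradiction (to p) ¬q
  ⟦⟧-cong (no ¬p) (yes q) _  from = contradiction (from q) ¬p
  ⟦⟧-cong (no _)  (no _)  _  _    = refl

  module _ {a} {A : Set a} where

    ∑-cong : ∀ (xs : List A) {f g : A → Carrier} → (∀ {x} → x ∈ xs → f x ≈ g x) →
             ∑ xs f ≈ ∑ xs g
    ∑-cong []       _  = refl
    ∑-cong (x ∷ xs) eq = +-cong (eq (here ≡.refl)) (∑-cong xs (eq ∘ there))

    ∑-zero : ∀ (xs : List A) {f : A → Carrier} → (∀ {x} → x ∈ xs → f x ≈ 0#) → ∑ xs f ≈ 0#
    ∑-zero []       _  = refl
    ∑-zero (x ∷ xs) eq = trans (+-cong (eq (here ≡.refl)) (∑-zero xs (eq ∘ there))) (+-identityˡ 0#)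

    ∑-+ : ∀ (xs : List A) (f g : A → Carrier) → ∑ xs (λ x → f x + g x) ≈ ∑ xs f + ∑ xs g
    ∑-+ []       f g = sym (+-identityˡ 0#)
    ∑-+ (x ∷ xs) f g = trans (+-congˡ (∑-+ xs f g)) (+.interchange _ _ _ _)

    *-∑ : ∀ (xs : List A) y {f : A → Carrier} → y * ∑ xs f ≈ ∑ xs (λ x → y * f x)
    *-∑ []       y = zeroʳ y
    *-∑ (x ∷ xs) y = trans (distribˡ y _ _) (+-congˡ (*-∑ xs y))

    ∑-* : ∀ (xs : List A) {f : A → Carrier} y → ∑ xs f * y ≈ ∑ xs (λ x → f x * y)
    ∑-* []       y = zeroˡ y
    ∑-* (x ∷ xs) y = trans (distribʳ y _ _) (+-congˡ (∑-* xs y))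

    ∑-filter : ∀ {p} {P : Pred A p} (P? : Decidable P) (xs : List A) {f : A → Carrier} →
               ∑ (List.filter P? xs) f ≈ ∑ xs (λ x → ⟦ P? x ⟧ * f x)
    ∑-filter P? []       = refl
    ∑-filter P? (x ∷ xs) with P? x
    ... | yes _ = +-cong (sym (*-identityˡ _)) (∑-filter P? xs)
    ... | no  _ = trans (∑-filter P? xs) (trans (sym (+-identityˡ _)) (+-congʳ (sym (zeroˡ _))))

    ∑-++ : ∀ (xs ys : List A) {f : A → Carrier} → ∑ (xs List.++ ys) f ≈ ∑ xs f + ∑ ys f
    ∑-++ []       ys = sym (+-identityˡ _)
    ∑-++ (x ∷ xs) ys = trans (+-congˡ (∑-++ xs ys)) (sym (+-assoc _ _ _))

    ∑-↭ : ∀ {xs ys} (f : A → Carrier) → xs ↭ ys → ∑ xs f ≈ ∑ ys f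
    ∑-↭ f xs↭ys = Permutation.foldr-commMonoid setoid +-isCommutativeMonoid
                    (↭⇒↭ₛ′ isEquivalence (map⁺ f xs↭ys))

    ∑-singleton : ∀ {xs x} (f : A → Carrier) → Unique xs → x ∈ xs →
                  (∀ {y} → y ∈ xs → y ≢ x → f y ≈ 0#) → ∑ xs f ≈ f x
    ∑-singleton f (x∉ ∷ _) (here ≡.refl) eq =
      trans (+-congˡ (∑-zero _ λ y∈ → eq (there y∈) (ListAll.lookup x∉ y∈ ∘ ≡.sym))) (+-identityʳ _)
    ∑-singleton f (y∉ ∷ xs!) (there x∈) eq =
      trans (+-cong (eq (here ≡.refl) (ListAll.lookup y∉ x∈))
                    (∑-singleton f xs! x∈ (eq ∘ there)))
            (+-identityˡ _)

  module _ {a b} {A : Set a} {B : Set b} where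

    ∑-map : ∀ (φ : A → B) xs {f : B → Carrier} → ∑ (List.map φ xs) f ≡ ∑ xs (f ∘ φ)
    ∑-map φ xs {f} = cong (List.foldr _+_ 0#) (≡.sym (List.map-∘ xs))

    ∑-reindex : ∀ (φ : A → B) {xs ys} → Unique xs → Unique ys →
                (∀ {x} → x ∈ xs → φ x ∈ ys) →
                (∀ {x y} → x ∈ xs → y ∈ xs → φ x ≡ φ y → x ≡ y) →
                (∀ {y} → y ∈ ys → ∃ λ x → x ∈ xs × y ≡ φ x) →
                ∀ (f : B → Carrier) → ∑ xs (f ∘ φ) ≈ ∑ ys f
    ∑-reindex φ {xs} xs! ys! φ∈ inj surj f =
      trans (reflexive (≡.sym (∑-map φ xs))) (∑-↭ f (map-bijection-↭ φ xs! ys! φ∈ inj surj))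

    ∑-swap : ∀ (xs : List A) (ys : List B) {f : A → B → Carrier} →
             ∑ xs (λ x → ∑ ys (f x)) ≈ ∑ ys (λ y → ∑ xs (λ x → f x y))
    ∑-swap []       ys = sym (∑-zero ys λ _ → refl)
    ∑-swap (x ∷ xs) ys = trans (+-congˡ (∑-swap xs ys)) (sym (∑-+ ys _ _))

  ∑-cartesianProductWith : ∀ {a b d} {A : Set a} {B : Set b} {D : Set d}
    (h : A → B → D) xs ys {f : D → Carrier} →
    ∑ (List.cartesianProductWith h xs ys) f ≈ ∑ xs (λ x → ∑ ys (λ y → f (h x y)))
  ∑-cartesianProductWith h []       ys = refl
  ∑-cartesianProductWith h (x ∷ xs) ys =
    trans (∑-++ (List.map (h x) ys) _)
          (+-cong (reflexive (∑-map (h x) ys)) (∑-cartesianProductWith h xs ys))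

-- Tensor powers of kernels

module Transforms {c ℓ₁ ℓ₂} (ℂ : ComplexExponentialField c ℓ₁ ℓ₂) where

  open Arithmetic ℂ
  open Sums ℂ
  open import Relation.Binary.Reasoning.Setoid setoid

  Kernel : Set c
  Kernel = ℕ → ℕ → Carrier

  -- The matrix K, with columns indexed by `xs`, applied to each of the m slots of the tensor a.
  -- `fourierSum` unfolds to an instance of it.
  transform : ∀ {m} → List ℕ → Kernel → (Vec ℕ m → Carrier) → Vec ℕ m → Carrier
  transform {m} xs K a ns = ∑ (tuples m xs) λ ls → a ls * ∏ (Vec.zipWith K ns ls)

  transform-cong : ∀ {m} xs (K : Kernel) {a b : Vec ℕ m → Carrier} →
                   (∀ {ls} → All (_∈ xs) ls → a ls ≈ b ls) →
                   ∀ ns → transform xs K a ns ≈ transform xs K b ns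
  transform-cong {m} xs K eq ns = ∑-cong (tuples m xs) λ ls∈ → *-congʳ (eq (∈-tuples⁻ m ls∈))

  transform-∷ : ∀ {m} xs (K : Kernel) (a : Vec ℕ (ℕ.suc m) → Carrier) n ns →
                transform xs K a (n ∷ ns) ≈
                ∑ xs λ x → K n x * transform xs K (λ ls → a (x ∷ ls)) ns
  transform-∷ {m} xs K a n ns = trans (∑-cartesianProductWith _∷_ xs (tuples m xs))
    (∑-cong xs λ {x} _ → trans
      (∑-cong (tuples m xs) λ _ → *.x∙yz≈y∙xz _ _ _)
      (sym (*-∑ (tuples m xs) (K n x))))

  transform-∑ : ∀ {m} xs (K : Kernel) ys (k : ℕ → Carrier) (a : ℕ → Vec ℕ m → Carrier) ns →
                transform xs K (λ ls → ∑ ys λ y → k y * a y ls) ns ≈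
                ∑ ys λ y → k y * transform xs K (a y) ns
  transform-∑ {m} xs K ys k a ns = begin
    ∑ (tuples m xs) (λ ls → ∑ ys (λ y → k y * a y ls) * ∏ (Vec.zipWith K ns ls))
      ≈⟨ ∑-cong (tuples m xs) (λ _ → ∑-* ys _) ⟩
    ∑ (tuples m xs) (λ ls → ∑ ys (λ y → k y * a y ls * ∏ (Vec.zipWith K ns ls)))
      ≈⟨ ∑-swap (tuples m xs) ys ⟩
    ∑ ys (λ y → ∑ (tuples m xs) (λ ls → k y * a y ls * ∏ (Vec.zipWith K ns ls)))
      ≈⟨ ∑-cong ys (λ {y} _ → trans (∑-cong (tuples m xs) (λ _ → *-assoc _ _ _))
                                     (sym (*-∑ (tuples m xs) (k y)))) ⟩
    ∑ ys (λ y → k y * transform xs K (a y) ns) ∎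

  -- Multiplicativity of tensor powers, by exchanging the sums over x and y one slot at a time. The
  -- one-variable identity is asked only where P and membership in `ys` hold, because the kernel
  -- identities need D ∣ N, or indices in {1,...,N}.
  transform-∘ : ∀ {p} {P : ℕ → Set p} {m} xs ys (K L M : Kernel) →
    (∀ {n y} → P n → y ∈ ys → ∑ xs (λ x → K n x * L x y) ≈ M n y) →
    ∀ (a : Vec ℕ m → Carrier) {ns} → All P ns →
    transform xs K (transform ys L a) ns ≈ transform ys M a ns
  transform-∘ xs ys K L M KL≈M a [] = trans (+-identityʳ _) (*-identityʳ _)
  transform-∘ xs ys K L M KL≈M a {n ∷ ns} (pn ∷ pns) = begin
    transform xs K (transform ys L a) (n ∷ ns)
      ≈⟨ transform-∷ xs K (transform ys L a) n ns ⟩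
    ∑ xs (λ x → K n x * transform xs K (λ ls → transform ys L a (x ∷ ls)) ns)
      -- The first slot of the inner transform is split off and, by linearity, its sum over `ys`
      -- leaves the outer transform.
      ≈⟨ ∑-cong xs (λ {x} _ → *-congˡ (trans
           (transform-cong xs K (λ {ls} _ → transform-∷ ys L a x ls) ns)
           (transform-∑ xs K ys (L x) (λ y → transform ys L (a ∘ (y ∷_))) ns))) ⟩
    ∑ xs (λ x → K n x * ∑ ys (λ y → L x y * T y))
      ≈⟨ ∑-cong xs (λ _ → trans (*-∑ ys _) (∑-cong ys (λ _ → sym (*-assoc _ _ _)))) ⟩
    ∑ xs (λ x → ∑ ys (λ y → K n x * L x y * T y))
      ≈⟨ ∑-swap xs ys ⟩
    ∑ ys (λ y → ∑ xs (λ x → K n x * L x y * T y))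
      ≈⟨ ∑-cong ys (λ {y} y∈ → trans (sym (∑-* xs _))
           (*-cong (KL≈M pn y∈) (transform-∘ xs ys K L M KL≈M (a ∘ (y ∷_)) pns))) ⟩
    ∑ ys (λ y → M n y * transform ys M (a ∘ (y ∷_)) ns)
      ≈⟨ transform-∷ ys M a n ns ⟨
    transform ys M a (n ∷ ns) ∎
    where
    T : ℕ → Carrier
    T y = transform xs K (transform ys L (a ∘ (y ∷_))) ns

  identity : Kernel
  identity n x = ⟦ n ℕ.≟ x ⟧

  transform-identity : ∀ {m} {xs} → Unique xs → ∀ (a : Vec ℕ m → Carrier) {ls} → All (_∈ xs) ls →
                       transform xs identity a ls ≈ a ls
  transform-identity xs! a [] = trans (+-identityʳ _) (*-identityʳ _)
  transform-identity {xs = xs} xs! a {l ∷ ls} (l∈ ∷ ls∈) = begin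
    transform xs identity a (l ∷ ls)
      ≈⟨ transform-∷ xs identity a l ls ⟩
    ∑ xs (λ x → ⟦ l ℕ.≟ x ⟧ * transform xs identity (a ∘ (x ∷_)) ls)
      ≈⟨ ∑-singleton _ xs! l∈ (λ {y} _ y≢l → ⟦⟧-*-no (l ℕ.≟ y) (y≢l ∘ ≡.sym)) ⟩
    ⟦ l ℕ.≟ l ⟧ * transform xs identity (a ∘ (l ∷_)) ls
      ≈⟨ ⟦⟧-*-yes (l ℕ.≟ l) ≡.refl ⟩
    transform xs identity (a ∘ (l ∷_)) ls
      ≈⟨ transform-identity xs! (a ∘ (l ∷_)) ls∈ ⟩
    a (l ∷ ls) ∎

  -- A one-variable left inverse L of K tensors up to a left inverse of the whole transform. P marks
  -- the points where the two transforms are known to agree; L samples the points of `ys`, so these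
  -- have to satisfy P.
  transform-injective : ∀ {p} {P : ℕ → Set p} {m} {xs} ys (K L : Kernel) → Unique xs →
    (∀ {y} → y ∈ ys → P y) →
    (∀ {l x} → l ∈ xs → x ∈ xs → ∑ ys (λ y → L l y * K y x) ≈ identity l x) →
    ∀ {a b : Vec ℕ m → Carrier} →
    (∀ {ns} → All P ns → transform xs K a ns ≈ transform xs K b ns) →
    ∀ {ls} → All (_∈ xs) ls → a ls ≈ b ls
  transform-injective {xs = xs} ys K L xs! ∈⇒P LK≈1 {a} {b} eq {ls} ls∈ = begin
    a ls                                      ≈⟨ inverse a ⟨
    transform ys L (transform xs K a) ls      ≈⟨ transform-cong ys L (eq ∘ All.map ∈⇒P) ls ⟩
    transform ys L (transform xs K b) ls      ≈⟨ inverse b ⟩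
    b ls                                      ∎
    where
    inverse : ∀ a → transform ys L (transform xs K a) ls ≈ a ls
    inverse a = trans (transform-∘ ys xs L K identity LK≈1 a ls∈)
                      (transform-identity xs! a ls∈)

-- Roots of unity

module Exponentials {c ℓ₁ ℓ₂} (ℂ : ComplexExponentialField c ℓ₁ ℓ₂) where

  open Arithmetic ℂ
  open Sums ℂ
  open RingProperties (CommutativeRing.ring commutativeRing)
    using (-‿distribˡ-*; -‿involutive; -1*x≈-x; +-cancelʳ; x∙y⁻¹≈ε⇒x≈y)
  open HeytingProperties heytingCommutativeRing using (x-0≈x; invertibleˡ⇒#; x#0y#0→xy#0)
  open Mult (CommutativeRing.semiring commutativeRing) using (×-homo-+; ×1-homo-*)
  open import Relation.Binary.Reasoning.Setoid setoid

  fromℕ-+ : ∀ m n → fromℕ (m ℕ.+ n) ≈ fromℕ m + fromℕ n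
  fromℕ-+ = ×-homo-+ 1#

  fromℕ-* : ∀ m n → fromℕ (m ℕ.* n) ≈ fromℕ m * fromℕ n
  fromℕ-* = ×1-homo-*

  #-cancelˡ : ∀ {x y z} → x # 0# → x * y ≈ x * z → y ≈ z
  #-cancelˡ {x} {y} {z} x#0 eq with x⁻¹ , inverseˡ , _ ← #⇒invertible x#0 = begin
    y                 ≈⟨ step y ⟨
    x⁻¹ * (x * y)     ≈⟨ *-congˡ eq ⟩
    x⁻¹ * (x * z)     ≈⟨ step z ⟩
    z                 ∎
    where
    step : ∀ w → x⁻¹ * (x * w) ≈ w
    step w = begin
      x⁻¹ * (x * w)       ≈⟨ *-assoc x⁻¹ x w ⟨
      x⁻¹ * x * w         ≈⟨ *-congʳ (*-congˡ (x-0≈x x)) ⟨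
      x⁻¹ * (x - 0#) * w  ≈⟨ *-congʳ inverseˡ ⟩
      1# * w              ≈⟨ *-identityˡ w ⟩
      w                   ∎

  #0-nonzero : ∀ {x} → x # 0# → ¬ x ≈ 0#
  #0-nonzero x#0 x≈0 = proj₂ (tight _ _) x≈0 x#0

  -- Tightness makes ≈ stable under double negation, so the invertible case can
  -- be assumed although x # 0# is not decidable.
  *-zero-cancelʳ : ∀ {x y} → ¬ y ≈ 0# → y * x ≈ 0# → x ≈ 0#
  *-zero-cancelʳ {x} {y} y≉0 yx≈0 = proj₁ (tight _ _) λ x#0 →
    y≉0 (#-cancelˡ x#0 (trans (*-comm x y) (trans yx≈0 (sym (zeroʳ x)))))

  -- Invertibility yields apartness, and the inverse of √-1 is its negative.
  √-1#0 : √-1 # 0#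
  √-1#0 = invertibleˡ⇒# (- √-1 , (begin
    - √-1 * (√-1 - 0#)    ≈⟨ *-congˡ (x-0≈x √-1) ⟩
    - √-1 * √-1           ≈⟨ -‿distribˡ-* √-1 √-1 ⟨
    - (√-1 * √-1)         ≈⟨ -‿cong √-1*√-1≈-1 ⟩
    - (- 1#)              ≈⟨ -‿involutive 1# ⟩
    1#                    ∎))

  2π√-1#0 : 2π√-1 # 0#
  2π√-1#0 = x#0y#0→xy#0 (x#0y#0→xy#0 (char-0 2) π#0) √-1#0

  fromℕ-nonzero : ∀ n .{{_ : NonZero n}} → ¬ fromℕ n ≈ 0#
  fromℕ-nonzero n = #0-nonzero (char-0 n)

  -- Equality would make the positive integer n - m vanish, against characteristic 0.
  fromℕ-<-≉ : ∀ {m n} → m < n → ¬ fromℕ m ≈ fromℕ n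
  fromℕ-<-≉ {m} {n} m<n eq = fromℕ-nonzero (n ℕ.∸ m) {{ℕ.>-nonZero (ℕ.m<n⇒0<n∸m m<n)}} (begin
    fromℕ (n ℕ.∸ m)                             ≈⟨ +-identityʳ _ ⟨
    fromℕ (n ℕ.∸ m) + 0#                        ≈⟨ +-congˡ (-‿inverseʳ (fromℕ m)) ⟨
    fromℕ (n ℕ.∸ m) + (fromℕ m - fromℕ m)       ≈⟨ +-assoc _ _ _ ⟨
    fromℕ (n ℕ.∸ m) + fromℕ m - fromℕ m         ≈⟨ +-congʳ (fromℕ-+ (n ℕ.∸ m) m) ⟨
    fromℕ (n ℕ.∸ m ℕ.+ m) - fromℕ m
      ≈⟨ +-congʳ (reflexive (cong fromℕ (ℕ.m∸n+n≡m (ℕ.<⇒≤ m<n)))) ⟩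
    fromℕ n - fromℕ m                           ≈⟨ +-congʳ eq ⟨
    fromℕ m - fromℕ m                           ≈⟨ -‿inverseʳ (fromℕ m) ⟩
    0#                                          ∎)

  fromℕ-injective : ∀ {m n} → fromℕ m ≈ fromℕ n → m ≡ n
  fromℕ-injective {m} {n} eq with ℕ.<-cmp m n
  ... | tri< m<n _ _ = contradiction eq (fromℕ-<-≉ m<n)
  ... | tri≈ _ m≡n _ = m≡n
  ... | tri> _ _ n<m = contradiction (sym eq) (fromℕ-<-≉ n<m)

  module _ (N : ℕ) .{{_ : NonZero N}} where

    *-1/ : fromℕ N * 1/ N ≈ 1#
    *-1/ = trans (*-congʳ (sym (x-0≈x _)))
                 (proj₂ (proj₂ (#⇒invertible (char-0 N))))

    e-+ : ∀ a b → e N (a ℕ.+ b) ≈ e N a * e N b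
    e-+ a b = trans (exp-cong (begin
      2π√-1 * fromℕ (a ℕ.+ b) * 1/ N              ≈⟨ *-congʳ (*-congˡ (fromℕ-+ a b)) ⟩
      2π√-1 * (fromℕ a + fromℕ b) * 1/ N          ≈⟨ *-congʳ (distribˡ _ _ _) ⟩
      (2π√-1 * fromℕ a + 2π√-1 * fromℕ b) * 1/ N  ≈⟨ distribʳ _ _ _ ⟩
      2π√-1 * fromℕ a * 1/ N + 2π√-1 * fromℕ b * 1/ N ∎)) (exp-+ _ _)

    e-∣ : ∀ {a} → N ∣ a → e N a ≈ 1#
    e-∣ {a} (divides k ≡.refl) = Equivalence.from (exp-kernel _) (+ k , (begin
      2π√-1 * fromℕ (k ℕ.* N) * 1/ N              ≈⟨ *-assoc _ _ _ ⟩
      2π√-1 * (fromℕ (k ℕ.* N) * 1/ N)            ≈⟨ *-congˡ (*-congʳ (fromℕ-* k N)) ⟩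
      2π√-1 * (fromℕ k * fromℕ N * 1/ N)          ≈⟨ *-congˡ (*-assoc _ _ _) ⟩
      2π√-1 * (fromℕ k * (fromℕ N * 1/ N))        ≈⟨ *-congˡ (*-congˡ *-1/) ⟩
      2π√-1 * (fromℕ k * 1#)                      ≈⟨ *-congˡ (*-identityʳ _) ⟩
      2π√-1 * fromℕ k                             ∎))

    -- The kernel of `exp` turns the hypothesis into 2π√-1 · a/N = 2π√-1 · k with an integer k.
    -- Cancelling 2π√-1 leaves a = kN in the field, and injectivity of `fromℕ` brings this back to
    -- ℕ.
    e-∣⁻ : ∀ {a} → e N a ≈ 1# → N ∣ a
    e-∣⁻ {a} eq with k , z≈ ← Equivalence.to (exp-kernel _) eq = conclude k (begin
      fromℕ a                                     ≈⟨ *-identityʳ _ ⟨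
      fromℕ a * 1#                                ≈⟨ *-congˡ (trans (*-comm _ _) *-1/) ⟨
      fromℕ a * (1/ N * fromℕ N)                  ≈⟨ *-assoc _ _ _ ⟨
      fromℕ a * 1/ N * fromℕ N
        ≈⟨ *-congʳ (#-cancelˡ 2π√-1#0 (trans (sym (*-assoc _ _ _)) z≈)) ⟩
      fromℤ k * fromℕ N                           ∎)
      where
      conclude : ∀ k → fromℕ a ≈ fromℤ k * fromℕ N → N ∣ a
      conclude (+ k)      eq = divides k (fromℕ-injective (trans eq (sym (fromℕ-* k N))))
      -- For a negative multiple the positive integer (k + 1)N + a would vanish in the field.
      conclude -[1+ k ] eq = contradiction (begin
        fromℕ (ℕ.suc k ℕ.* N ℕ.+ a)                     ≈⟨ fromℕ-+ (ℕ.suc k ℕ.* N) a ⟩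
        fromℕ (ℕ.suc k ℕ.* N) + fromℕ a                 ≈⟨ +-cong (fromℕ-* (ℕ.suc k) N) eq ⟩
        fromℕ (ℕ.suc k) * fromℕ N + - fromℕ (ℕ.suc k) * fromℕ N ≈⟨ distribʳ _ _ _ ⟨
        (fromℕ (ℕ.suc k) - fromℕ (ℕ.suc k)) * fromℕ N   ≈⟨ *-congʳ (-‿inverseʳ _) ⟩
        0# * fromℕ N                                    ≈⟨ zeroˡ _ ⟩
        0#                                              ∎)
        (fromℕ-nonzero _ {{ℕ.>-nonZero (ℕ.<-≤-trans (ℕ.>-nonZero⁻¹ N)
          (ℕ.≤-trans (ℕ.m≤m+n N (k ℕ.* N)) (ℕ.m≤m+n _ a)))}})

  ∑-upTo-suc : ∀ n (f : ℕ → Carrier) → ∑ (List.upTo (ℕ.suc n)) f ≈ f 0 + ∑ (List.upTo n) (f ∘ ℕ.suc)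
  ∑-upTo-suc n f = +-congˡ (reflexive (≡.trans
    (cong (λ xs → ∑ xs f) (≡.sym (List.map-upTo ℕ.suc n))) (∑-map ℕ.suc (List.upTo n))))

  ∑-range⁺ : ∀ n (f : ℕ → Carrier) → ∑ (range⁺ n) f ≈ ∑ (List.upTo n) (f ∘ ℕ.suc)
  ∑-range⁺ n f = reflexive (∑-map ℕ.suc (List.upTo n))

  -- Both sides are f 0 + ⋯ + f n. When f 0 = f n, as over a full period, the shifted sum therefore
  -- equals the original one.
  ∑-upTo-shift : ∀ n (f : ℕ → Carrier) →
                 ∑ (List.upTo n) (f ∘ ℕ.suc) + f 0 ≈ ∑ (List.upTo n) f + f n
  ∑-upTo-shift ℕ.zero    f = refl
  ∑-upTo-shift (ℕ.suc n) f = begin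
    ∑ (List.upTo (ℕ.suc n)) (f ∘ ℕ.suc) + f 0
      ≈⟨ +-congʳ (trans (∑-upTo-suc n _) (trans (+-comm _ _) (∑-upTo-shift n (f ∘ ℕ.suc)))) ⟩
    ∑ (List.upTo n) (f ∘ ℕ.suc) + f (ℕ.suc n) + f 0
      ≈⟨ +.xy∙z≈zx∙y _ _ _ ⟩
    f 0 + ∑ (List.upTo n) (f ∘ ℕ.suc) + f (ℕ.suc n)
      ≈⟨ +-congʳ (∑-upTo-suc n f) ⟨
    ∑ (List.upTo (ℕ.suc n)) f + f (ℕ.suc n) ∎

  ∑-range⁺-1 : ∀ n → ∑ (range⁺ n) (λ _ → 1#) ≈ fromℕ n
  ∑-range⁺-1 n = trans (∑-range⁺ n _) (go n)
    where
    go : ∀ n → ∑ (List.upTo n) (λ _ → 1#) ≈ fromℕ n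
    go ℕ.zero    = refl
    go (ℕ.suc n) = trans (∑-upTo-suc n (λ _ → 1#)) (+-congˡ (go n))

  -- Shifting the summation index multiplies the sum by e(N, qn), which is 1 only if D ∣ n.
  ∑-e : ∀ N .{{_ : NonZero N}} {D q} n → N ≡ q ℕ.* D →
        ∑ (range⁺ D) (λ l → e N (n ℕ.* (q ℕ.* l))) ≈ ⟦ D ∣? n ⟧ * fromℕ D
  ∑-e N {D} {q} n N≡qD with D ∣? n
  ... | yes D∣n = trans (trans (∑-cong (range⁺ D) λ {l} _ → e-∣ N (N∣ l)) (∑-range⁺-1 D)) (sym (*-identityˡ _))
    where
    N∣ : ∀ l → N ∣ n ℕ.* (q ℕ.* l)
    N∣ l = ≡.subst₂ _∣_ (≡.trans (ℕ.*-comm D q) (≡.sym N≡qD)) (ℕ.*-assoc n q l)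
                    (∣m⇒∣m*n l (*-pres-∣ D∣n ∣-refl))
  ... | no D∤n = trans (*-zero-cancelʳ z-1≉0 (begin
    (z - 1#) * Σ            ≈⟨ distribʳ _ _ _ ⟩
    z * Σ + - 1# * Σ        ≈⟨ +-cong zΣ≈Σ (-1*x≈-x Σ) ⟩
    Σ - Σ                   ≈⟨ -‿inverseʳ Σ ⟩
    0#                      ∎)) (sym (zeroˡ _))
    where
    f : ℕ → Carrier
    f l = e N (n ℕ.* (q ℕ.* l))
    z = e N (n ℕ.* q)
    Σ = ∑ (range⁺ D) f
    instance
      q≢0 : NonZero q
      q≢0 = ∣-nonZero (divides D (≡.trans N≡qD (ℕ.*-comm q D)))
    z-1≉0 : ¬ z - 1# ≈ 0#
    z-1≉0 eq = D∤n (*-cancelʳ-∣ q (subst (_∣ n ℕ.* q) (≡.trans N≡qD (ℕ.*-comm q D))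
      (e-∣⁻ N (x∙y⁻¹≈ε⇒x≈y z 1# eq))))
    f-suc : ∀ l → z * f l ≈ f (ℕ.suc l)
    f-suc l = trans (sym (e-+ N (n ℕ.* q) _)) (reflexive (cong (e N)
      (≡.trans (≡.sym (ℕ.*-distribˡ-+ n q (q ℕ.* l))) (cong (n ℕ.*_) (≡.sym (ℕ.*-suc q l))))))
    f0≈fD : f 0 ≈ f D
    f0≈fD = trans (e-∣ N (subst (N ∣_) 
      (≡.trans (≡.sym (ℕ.*-zeroʳ n)) (cong (n ℕ.*_) (≡.sym (ℕ.*-zeroʳ q)))) (N ∣0)))
                  (sym (e-∣ N (∣n⇒∣m*n n (∣-reflexive N≡qD))))
    zΣ≈Σ : z * Σ ≈ Σ
    zΣ≈Σ = begin
      z * Σ                                     ≈⟨ *-congˡ (trans (∑-range⁺ D f) shift) ⟩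
      z * ∑ (List.upTo D) f                     ≈⟨ *-∑ (List.upTo D) z ⟩
      ∑ (List.upTo D) (λ l → z * f l)           ≈⟨ ∑-cong (List.upTo D) (λ {l} _ → f-suc l) ⟩
      ∑ (List.upTo D) (f ∘ ℕ.suc)               ≈⟨ ∑-range⁺ D f ⟨
      Σ                                         ∎
      where
      shift : ∑ (List.upTo D) (f ∘ ℕ.suc) ≈ ∑ (List.upTo D) f
      shift = +-cancelʳ (f D) _ _ (trans (+-congˡ (sym f0≈fD)) (∑-upTo-shift D f))

-- The number (N ∸ l) + k lies strictly between 0 and 2N, so as a multiple of N it can only be N.
∣∸+⇒≡ : ∀ {N l k} → NonZero l × l ≤ N → NonZero k × k ≤ N → N ∣ (N ℕ.∸ l) ℕ.+ k → l ≡ k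
∣∸+⇒≡ {N} {l} {k} (l≢0 , l≤N) (k≢0 , k≤N) N∣ = ℕ.+-cancelˡ-≡ (N ℕ.∸ l) l k
  (≡.trans (ℕ.m∸n+n≡m l≤N) (≡.sym (quotient≡1 N∣)))
  where
  open ℕ.≤-Reasoning
  quotient≡1 : N ∣ (N ℕ.∸ l) ℕ.+ k → (N ℕ.∸ l) ℕ.+ k ≡ N
  quotient≡1 (divides 0 eq) = contradiction (ℕ.m+n≡0⇒n≡0 (N ℕ.∸ l) eq) (ℕ.≢-nonZero⁻¹ k {{k≢0}})
  quotient≡1 (divides 1 eq) = ≡.trans eq (ℕ.+-identityʳ N)
  quotient≡1 (divides (ℕ.suc (ℕ.suc q)) eq) = contradiction (begin-strict
    N ℕ.+ N                       ≤⟨ ℕ.+-monoʳ-≤ N (ℕ.m≤m+n N (q ℕ.* N)) ⟩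
    N ℕ.+ (N ℕ.+ q ℕ.* N)         ≡⟨ eq ⟨
    (N ℕ.∸ l) ℕ.+ k               <⟨ ℕ.+-mono-<-≤ (ℕ.∸-monoʳ-< (ℕ.>-nonZero⁻¹ l {{l≢0}}) l≤N) k≤N ⟩
    N ℕ.+ N                       ∎) (ℕ.<-irrefl ≡.refl)

-- Fourier and divisibility kernels

module FourierKernels {c ℓ₁ ℓ₂} (ℂ : ComplexExponentialField c ℓ₁ ℓ₂) where

  open Arithmetic ℂ
  open Sums ℂ
  open Transforms ℂ
  open Exponentials ℂ
  open import Relation.Binary.Reasoning.Setoid setoid

  ∑-multiples : ∀ {N q D} .{{_ : NonZero N}} (f : ℕ → Carrier) → N ≡ q ℕ.* D →
                ∑ (range⁺ N) (λ l → ⟦ q ∣? l ⟧ * f l) ≈ ∑ (range⁺ D) (λ l → f (q ℕ.* l))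
  ∑-multiples {N} {q} {D} f N≡qD = trans (sym (∑-filter (q ∣?_) (range⁺ N)))
    (sym (∑-reindex (q ℕ.*_) (range⁺-unique D) (Unique.filter⁺ (q ∣?_) (range⁺-unique N))
      (λ {k} k∈ → let k≢0 , k≤D = ∈-range⁻ k∈ in ∈-filter⁺ (q ∣?_)
        (∈-range⁺ {{ℕ.m*n≢0 q k {{q≢0}} {{k≢0}}}} (subst (q ℕ.* k ≤_) (≡.sym N≡qD) (ℕ.*-monoʳ-≤ q k≤D)))
        (m∣m*n k))
      (λ _ _ → ℕ.*-cancelˡ-≡ _ _ q)
      surjective f))
    where
    instance
      q≢0 : NonZero q
      q≢0 = ∣-nonZero (divides D (≡.trans N≡qD (ℕ.*-comm q D)))
    surjective : ∀ {l} → l ∈ List.filter (q ∣?_) (range⁺ N) → ∃ λ k → k ∈ range⁺ D × l ≡ q ℕ.* k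
    surjective l∈ with ∈-filter⁻ (q ∣?_) {xs = range⁺ N} l∈
    ... | l∈range , divides k ≡.refl =
      k , ∈-range⁺ {{ℕ.m*n≢0⇒m≢0 k {{proj₁ (∈-range⁻ l∈range)}}}}
            (ℕ.*-cancelʳ-≤ k D q (subst (k ℕ.* q ≤_) (≡.trans N≡qD (ℕ.*-comm q D)) (proj₂ (∈-range⁻ l∈range))))
        , ℕ.*-comm k q

  module _ (N : ℕ) .{{_ : NonZero N}} where

    fourierKernel : Kernel
    fourierKernel n l = e N (n ℕ.* l)

    -- `N ∸ l` represents -l modulo N without leaving ℕ; this is correct for the l ≤ N at which the
    -- kernel is used.
    inverseFourierKernel : Kernel
    inverseFourierKernel l n = 1/ N * e N (n ℕ.* (N ℕ.∸ l))

    divisibilityKernel : Kernel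
    divisibilityKernel n D = ⟦ D ∣? n ⟧

    -- The weight is 1/D, kept as (1/N)(N/D) because the coefficients supply exactly these two
    -- factors.
    codivisibilityKernel : Kernel
    codivisibilityKernel l D = 1/ N * (fromℕ (N ÷ D) * ⟦ (N ÷ D) ∣? l ⟧)

    -- Read as a Fourier expansion: D [D ∣ n] has coefficient 1 at the multiples of N/D and 0 at the
    -- other frequencies.
    ∑-e-multiples : ∀ {D} n → D ∣ N →
                    ∑ (range⁺ N) (λ l → ⟦ (N ÷ D) ∣? l ⟧ * e N (n ℕ.* l)) ≈ ⟦ D ∣? n ⟧ * fromℕ D
    ∑-e-multiples {D} n D∣N =
      trans (∑-multiples {q = N ÷ D} {D} (λ l → e N (n ℕ.* l)) (≡.sym (÷-exact D∣N)))
            (∑-e N {D} {N ÷ D} n (≡.sym (÷-exact D∣N)))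

    1/-*-÷ : ∀ {D} → D ∣ N → 1/ N * fromℕ (N ÷ D) * fromℕ D ≈ 1#
    1/-*-÷ {D} D∣N = begin
      1/ N * fromℕ (N ÷ D) * fromℕ D    ≈⟨ *-assoc _ _ _ ⟩
      1/ N * (fromℕ (N ÷ D) * fromℕ D)  ≈⟨ *-congˡ (fromℕ-* (N ÷ D) D) ⟨
      1/ N * fromℕ ((N ÷ D) ℕ.* D)      ≈⟨ *-congˡ (reflexive (cong fromℕ (÷-exact D∣N))) ⟩
      1/ N * fromℕ N                    ≈⟨ trans (*-comm _ _) (*-1/ N) ⟩
      1#                                ∎

    fourier-codivisibility : ∀ {n D} → D ∣ N →
      ∑ (range⁺ N) (λ l → fourierKernel n l * codivisibilityKernel l D) ≈ divisibilityKernel n D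
    fourier-codivisibility {n} {D} D∣N = begin
      ∑ (range⁺ N) (λ l → e N (n ℕ.* l) * (1/ N * (fromℕ (N ÷ D) * ⟦ (N ÷ D) ∣? l ⟧)))
        ≈⟨ ∑-cong (range⁺ N) (λ _ → trans (*-comm _ _) (trans (*-congʳ (sym (*-assoc _ _ _))) (*-assoc _ _ _))) ⟩
      ∑ (range⁺ N) (λ l → 1/ N * fromℕ (N ÷ D) * (⟦ (N ÷ D) ∣? l ⟧ * e N (n ℕ.* l)))
        ≈⟨ *-∑ (range⁺ N) _ ⟨
      1/ N * fromℕ (N ÷ D) * ∑ (range⁺ N) (λ l → ⟦ (N ÷ D) ∣? l ⟧ * e N (n ℕ.* l))
        ≈⟨ *-congˡ (trans (∑-e-multiples n D∣N) (*-comm _ _)) ⟩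
      1/ N * fromℕ (N ÷ D) * (fromℕ D * ⟦ D ∣? n ⟧)
        ≈⟨ trans (sym (*-assoc _ _ _)) (*-congʳ (1/-*-÷ D∣N)) ⟩
      1# * ⟦ D ∣? n ⟧
        ≈⟨ *-identityˡ _ ⟩
      ⟦ D ∣? n ⟧ ∎

    inverseFourier-fourier : ∀ {l k} → l ∈ range⁺ N → k ∈ range⁺ N →
      ∑ (range⁺ N) (λ n → inverseFourierKernel l n * fourierKernel n k) ≈ identity l k
    inverseFourier-fourier {l} {k} l∈ k∈ = begin
      ∑ (range⁺ N) (λ n → 1/ N * e N (n ℕ.* (N ℕ.∸ l)) * e N (n ℕ.* k))
        ≈⟨ ∑-cong (range⁺ N) (λ {n} _ → trans (*-assoc _ _ _) (*-congˡ (trans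
             (sym (e-+ N (n ℕ.* (N ℕ.∸ l)) (n ℕ.* k)))
             (reflexive (cong (e N) (exponent n)))))) ⟩
      ∑ (range⁺ N) (λ n → 1/ N * e N (((N ℕ.∸ l) ℕ.+ k) ℕ.* (1 ℕ.* n)))
        ≈⟨ *-∑ (range⁺ N) _ ⟨
      1/ N * ∑ (range⁺ N) (λ n → e N (((N ℕ.∸ l) ℕ.+ k) ℕ.* (1 ℕ.* n)))
        -- The geometric sum for D = N and q = 1, whence the factor 1 in the exponent; n is now the
        -- summation index and (N ∸ l) + k the frequency.
        ≈⟨ *-congˡ (∑-e N {N} {1} ((N ℕ.∸ l) ℕ.+ k) (≡.sym (ℕ.*-identityˡ N))) ⟩
      1/ N * (⟦ N ∣? ((N ℕ.∸ l) ℕ.+ k) ⟧ * fromℕ N)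
        ≈⟨ trans (*.x∙yz≈zx∙y _ _ _) (*-congʳ (*-1/ N)) ⟩
      1# * ⟦ N ∣? ((N ℕ.∸ l) ℕ.+ k) ⟧
        ≈⟨ *-identityˡ _ ⟩
      ⟦ N ∣? ((N ℕ.∸ l) ℕ.+ k) ⟧
        ≈⟨ ⟦⟧-cong (N ∣? ((N ℕ.∸ l) ℕ.+ k)) (l ℕ.≟ k) (∣∸+⇒≡ (∈-range⁻ l∈) (∈-range⁻ k∈))
             (λ { ≡.refl → ∣-reflexive (≡.sym (ℕ.m∸n+n≡m (proj₂ (∈-range⁻ l∈)))) }) ⟩
      identity l k ∎
      where
      exponent : ∀ n → n ℕ.* (N ℕ.∸ l) ℕ.+ n ℕ.* k ≡ ((N ℕ.∸ l) ℕ.+ k) ℕ.* (1 ℕ.* n)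
      exponent n = ≡.trans (≡.sym (ℕ.*-distribˡ-+ n (N ℕ.∸ l) k))
        (≡.trans (ℕ.*-comm n ((N ℕ.∸ l) ℕ.+ k)) (cong (((N ℕ.∸ l) ℕ.+ k) ℕ.*_) (≡.sym (ℕ.*-identityˡ n))))

-- Möbius function

-- A prime that does not divide t is coprime to t, so Euclid's lemma applies.
∣-prime-cancel : ∀ {p k t} → Prime p → ¬ p ∣ t → t ∣ p ℕ.* k → t ∣ k
∣-prime-cancel {p} {k} {t} p-prime p∤t = coprime-divisor coprime
  where
  coprime : ∀ {d} → d ∣ t × d ∣ p → d ≡ 1
  coprime (d∣t , d∣p) with prime⇒irreducible p-prime d∣p
  ... | inj₁ d≡1    = d≡1
  ... | inj₂ ≡.refl = contradiction d∣t p∤t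

∈-∣-product : ∀ {p ps} → p ∈ ps → p ∣ product ps
∈-∣-product {ps = _ ∷ ps} (here ≡.refl) = m∣m*n (product ps)
∈-∣-product {ps = q ∷ _}  (there p∈)    = ∣n⇒∣m*n q (∈-∣-product p∈)

module Möbius {c ℓ₁ ℓ₂} (ℂ : ComplexExponentialField c ℓ₁ ℓ₂) where

  open Arithmetic ℂ
  open Sums ℂ
  open RingProperties (CommutativeRing.ring commutativeRing) using (-0#≈0#; -1*x≈-x)
  open import Relation.Binary.Reasoning.Setoid setoid

  -- The value of μ read off a list of prime factors; for n > 0, `μ n` unfolds to `sign` of the
  -- chosen factorisation. Working with lists allows a change of factorisation.
  sign : List ℕ → Carrier
  sign ps = if does (unique? ps) then (- 1#) ^ᶜ List.length ps else 0#

  sign-unique : ∀ ps → Unique ps → sign ps ≈ (- 1#) ^ᶜ List.length ps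
  sign-unique ps ps! with unique? ps
  ... | yes _  = refl
  ... | no ¬ps! = contradiction ps! ¬ps!

  sign-¬unique : ∀ ps → ¬ Unique ps → sign ps ≈ 0#
  sign-¬unique ps ¬ps! with unique? ps
  ... | yes ps! = contradiction ps! ¬ps!
  ... | no _    = refl

  sign-↭ : ∀ {ps qs} → ps ↭ qs → sign ps ≈ sign qs
  sign-↭ {ps} {qs} ps↭qs with unique? ps
  ... | yes ps! = trans (reflexive (cong ((- 1#) ^ᶜ_) (↭-length ps↭qs)))
                        (sym (sign-unique qs (Permutation.Unique-resp-↭ (≡.setoid ℕ) (↭⇒↭ₛ ps↭qs) ps!)))
  ... | no ¬ps! = sym (sign-¬unique qs
      (¬ps! ∘ Permutation.Unique-resp-↭ (≡.setoid ℕ) (↭⇒↭ₛ (↭-sym ps↭qs))))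

  sign-∷-∉ : ∀ p ps → p ∉ ps → sign (p ∷ ps) ≈ - sign ps
  sign-∷-∉ p ps p∉ps = go (unique? ps)
    where
    go : Dec (Unique ps) → sign (p ∷ ps) ≈ - sign ps
    go (yes ps!) = trans (sign-unique (p ∷ ps) (ListAll.tabulate (λ { q∈ ≡.refl → p∉ps q∈ }) ∷ ps!))
                         (trans (-1*x≈-x _) (-‿cong (sym (sign-unique ps ps!))))
    go (no ¬ps!) = trans (sign-¬unique (p ∷ ps) λ { (_ ∷ ps!) → ¬ps! ps! })
                         (trans (sym -0#≈0#) (-‿cong (sym (sign-¬unique ps ¬ps!))))

  -- Factorisations are unique up to order and `sign` ignores order, so any of them computes μ, for
  -- instance p followed by the factors of s.
  μ-factors : ∀ {n} .{{_ : NonZero n}} (F : PrimeFactorisation n) → μ n ≈ sign (factors F)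
  μ-factors {ℕ.suc n} F = sign-↭ (factorisationUnique (factorise (ℕ.suc n)) F)

  module _ {p} (p-prime : Prime p) {s : ℕ} .{{s≢0 : NonZero s}} where

    μ-prime-* : μ (p ℕ.* s) ≈ sign (p ∷ factors (factorise s))
    μ-prime-* = μ-factors {{ℕ.m*n≢0 p s {{prime⇒nonZero p-prime}}}} record
      { factors         = p ∷ factors (factorise s)
      ; isFactorisation = cong (p ℕ.*_) (isFactorisation (factorise s))
      ; factorsPrime    = p-prime ListAll.∷ factorsPrime (factorise s)
      }

    -- p already occurs among the prime factors of s, so prefixing it creates a repetition.
    μ-prime-*-∣ : p ∣ s → μ (p ℕ.* s) ≈ 0#
    μ-prime-*-∣ p∣s = trans μ-prime-* (sign-¬unique (p ∷ factors (factorise s)) λ { (p∉ ∷ _) →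
      ListAll.lookup p∉ (factorisationHasAllPrimeFactors p-prime
        (subst (p ∣_) (isFactorisation (factorise s)) p∣s) (factorsPrime (factorise s))) ≡.refl })

    μ-prime-*-∤ : ¬ p ∣ s → μ (p ℕ.* s) ≈ - μ s
    μ-prime-*-∤ p∤s = trans μ-prime-* (trans
      (sign-∷-∉ p (factors (factorise s)) λ p∈ →
        p∤s (subst (p ∣_) (≡.sym (isFactorisation (factorise s)))
                   (∈-∣-product {ps = factors (factorise s)} p∈)))
      (-‿cong (sym (μ-factors (factorise s)))))

  ∑-partition : ∀ {a q} {A : Set a} {P : Pred A q} (P? : Decidable P) (xs : List A) {f : A → Carrier} →
                ∑ xs f ≈ ∑ (List.filter P? xs) f + ∑ (List.filter (¬? ∘ P?) xs) f
  ∑-partition P? []       = sym (+-identityˡ 0#)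
  ∑-partition P? (x ∷ xs) with P? x
  ... | yes _ = trans (+-congˡ (∑-partition P? xs)) (sym (+-assoc _ _ _))
  ... | no  _ = trans (+-congˡ (∑-partition P? xs)) (+.x∙yz≈y∙xz _ _ _)

  -- For a prime p dividing n, the terms μ(t) with p ∤ t cancel against μ(pt).
  ∑-μ-prime : ∀ {p k} → Prime p → .{{_ : NonZero k}} → ∑ (divisors (p ℕ.* k)) μ ≈ 0#
  ∑-μ-prime {p} {k} p-prime = begin
    ∑ (divisors (p ℕ.* k)) μ
      ≈⟨ ∑-partition (p ∣?_) (divisors (p ℕ.* k)) ⟩
    ∑ (List.filter (p ∣?_) (divisors (p ℕ.* k))) μ + ∑ (List.filter p∤? (divisors (p ℕ.* k))) μ
      ≈⟨ +-cong divisible coprime ⟩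
    ∑ (List.filter p∤? (divisors k)) (λ t → - μ t) + ∑ (List.filter p∤? (divisors k)) μ
      ≈⟨ ∑-+ (List.filter p∤? (divisors k)) _ _ ⟨
    ∑ (List.filter p∤? (divisors k)) (λ t → - μ t + μ t)
      ≈⟨ ∑-zero (List.filter p∤? (divisors k)) (λ _ → -‿inverseˡ _) ⟩
    0# ∎
    where
    p∤? = ¬? ∘ (p ∣?_)
    instance
      p≢0 : NonZero p
      p≢0 = prime⇒nonZero p-prime
      pk≢0 : NonZero (p ℕ.* k)
      pk≢0 = ℕ.m*n≢0 p k

    coprime : ∑ (List.filter p∤? (divisors (p ℕ.* k))) μ ≈ ∑ (List.filter p∤? (divisors k)) μ
    coprime = sym (∑-reindex id (Unique.filter⁺ p∤? (divisors-unique k))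
      (Unique.filter⁺ p∤? (divisors-unique (p ℕ.* k)))
      (λ t∈ → let t∣k , p∤t = ∈-filter⁻ p∤? {xs = divisors k} t∈ in
        ∈-filter⁺ p∤? (∈-divisors⁺ (∣n⇒∣m*n p (∈-divisors⁻ {n = k} t∣k))) p∤t)
      (λ _ _ → id)
      (λ {t} t∈ → let t∣pk , p∤t = ∈-filter⁻ p∤? {xs = divisors (p ℕ.* k)} t∈ in
        t , ∈-filter⁺ p∤? (∈-divisors⁺ (∣-prime-cancel p-prime p∤t (∈-divisors⁻ {n = p ℕ.* k} t∣pk))) p∤t
          , ≡.refl)
      μ)

    divisible : ∑ (List.filter (p ∣?_) (divisors (p ℕ.* k))) μ ≈
                ∑ (List.filter p∤? (divisors k)) (λ t → - μ t)
    divisible = begin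
      ∑ (List.filter (p ∣?_) (divisors (p ℕ.* k))) μ
        ≈⟨ ∑-reindex (p ℕ.*_) (divisors-unique k) (Unique.filter⁺ (p ∣?_) (divisors-unique (p ℕ.* k)))
             (λ {t} t∈ → ∈-filter⁺ (p ∣?_) (∈-divisors⁺ (*-monoʳ-∣ p (∈-divisors⁻ {n = k} t∈))) (m∣m*n t))
             (λ _ _ → ℕ.*-cancelˡ-≡ _ _ p)
             (λ t∈ → quotient∈ (∈-filter⁻ (p ∣?_) {xs = divisors (p ℕ.* k)} t∈))
             μ ⟨
      ∑ (divisors k) (λ t → μ (p ℕ.* t))
        -- If p ∣ t then p² ∣ pt and μ(pt) vanishes, so only the t with p ∤ t survive.
        ≈⟨ ∑-cong (divisors k) (λ {t} t∈ → sym (⟦⟧-* (p∤? t)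
             (λ p∤t → sym (μ-prime-*-∤ p-prime {{∣-nonZero (∈-divisors⁻ {n = k} t∈)}} p∤t))
             (λ ¬p∤t → μ-prime-*-∣ p-prime {{∣-nonZero (∈-divisors⁻ {n = k} t∈)}}
               (decidable-stable (p ∣? t) ¬p∤t)))) ⟩
      ∑ (divisors k) (λ t → ⟦ p∤? t ⟧ * - μ t)
        ≈⟨ ∑-filter p∤? (divisors k) ⟨
      ∑ (List.filter p∤? (divisors k)) (λ t → - μ t) ∎
      where
      quotient∈ : ∀ {t} → t ∈ divisors (p ℕ.* k) × p ∣ t → ∃ λ s → s ∈ divisors k × t ≡ p ℕ.* s
      quotient∈ (t∈ , divides s ≡.refl) =
        s , ∈-divisors⁺ (*-cancelˡ-∣ p (subst (_∣ p ℕ.* k) (ℕ.*-comm s p) (∈-divisors⁻ {n = p ℕ.* k} t∈)))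
          , ℕ.*-comm s p

  ∑-μ : ∀ n .{{_ : NonZero n}} → ∑ (divisors n) μ ≈ ⟦ n ℕ.≟ 1 ⟧
  ∑-μ n with factorise n
  -- The empty product: n is 1 and the sum evaluates to 1 + 0.
  ... | record { factors = [] ; isFactorisation = ≡.refl } = +-identityʳ 1#
  ... | record { factors = p ∷ ps ; isFactorisation = ≡.refl ; factorsPrime = p-prime ListAll.∷ _ } =
    trans (∑-μ-prime p-prime {{ℕ.m*n≢0⇒n≢0 p}})
          (sym (⟦⟧-no (p ℕ.* product ps ℕ.≟ 1)
            (ℕ.nonTrivial⇒≢1 {{prime⇒nonTrivial p-prime}} ∘ ℕ.m*n≡1⇒m≡1 p _)))

-- Ramanujan sums

module RamanujanKernels {c ℓ₁ ℓ₂} (ℂ : ComplexExponentialField c ℓ₁ ℓ₂) (N : ℕ) .{{N≢0 : NonZero N}} where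

  open Arithmetic ℂ
  open Sums ℂ
  open Transforms ℂ
  open FourierKernels ℂ
  open Möbius ℂ
  open import Relation.Binary.Reasoning.Setoid setoid

  ∑-complement : ∀ (f : ℕ → Carrier) → ∑ (divisors N) (f ∘ (N ÷_)) ≈ ∑ (divisors N) f
  ∑-complement f = ∑-reindex (N ÷_) (divisors-unique N) (divisors-unique N)
    (∈-divisors⁺ ∘ ÷-∣ ∘ ∈-divisors⁻ {n = N})
    (λ d∈ e∈ → ÷-injective (∈-divisors⁻ d∈) (∈-divisors⁻ e∈))
    (λ {d} d∈ → N ÷ d , ∈-divisors⁺ (÷-∣ (∈-divisors⁻ d∈)) , ≡.sym (÷-involutive (∈-divisors⁻ {n = N} d∈)))
    f

  ∑-filter² : ∀ {p q} {P : ℕ → Set p} {Q : ℕ → Set q} (P? : ∀ k → Dec (P k)) (Q? : ∀ k → Dec (Q k))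
              (xs : List ℕ) {f : ℕ → Carrier} →
              ∑ (List.filter Q? (List.filter P? xs)) f ≈ ∑ xs (λ k → ⟦ P? k ⟧ * (⟦ Q? k ⟧ * f k))
  ∑-filter² P? Q? xs = trans (∑-filter Q? (List.filter P? xs)) (∑-filter P? xs)

  -- Moves the conditions on k into indicators, so that the index set no longer depends on d and n
  -- and the sums can be exchanged.
  ramanujan-expansion : ∀ {d} n → d ∣ N →
    ramanujan d n ≈ ∑ (divisors N) (λ k → ⟦ k ∣? d ⟧ * μ (d ÷ k) * (⟦ k ∣? n ⟧ * fromℕ k))
  ramanujan-expansion {d} n d∣N = begin
    ∑ (divisors (gcd d n)) (λ k → μ (d ÷ k) * fromℕ k)
      ≈⟨ ∑-reindex id (divisors-unique (gcd d n))
           (Unique.filter⁺ (_∣? n) (Unique.filter⁺ (_∣? d) (divisors-unique N)))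
           (λ k∈ → let k∣g = ∈-divisors⁻ {n = gcd d n} k∈
                       k∣d = ∣-trans k∣g (gcd[m,n]∣m d n) in
             ∈-filter⁺ (_∣? n) (∈-filter⁺ (_∣? d) (∈-divisors⁺ (∣-trans k∣d d∣N)) k∣d)
                       (∣-trans k∣g (gcd[m,n]∣n d n)))
           (λ _ _ → id)
           (λ {k} k∈ → let k∈′ , k∣n = ∈-filter⁻ (_∣? n) {xs = List.filter (_∣? d) (divisors N)} k∈
                           _ , k∣d   = ∈-filter⁻ (_∣? d) {xs = divisors N} k∈′ in
             k , ∈-divisors⁺ {{∣-nonZero {{∣-nonZero d∣N}} (gcd[m,n]∣m d n)}} (gcd-greatest k∣d k∣n) , ≡.refl)
           (λ k → μ (d ÷ k) * fromℕ k) ⟩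
    ∑ (List.filter (_∣? n) (List.filter (_∣? d) (divisors N))) (λ k → μ (d ÷ k) * fromℕ k)
      ≈⟨ ∑-filter² (_∣? d) (_∣? n) (divisors N) ⟩
    ∑ (divisors N) (λ k → ⟦ k ∣? d ⟧ * (⟦ k ∣? n ⟧ * (μ (d ÷ k) * fromℕ k)))
      ≈⟨ ∑-cong (divisors N) (λ _ → trans (*-congˡ (*.x∙yz≈y∙xz _ _ _)) (sym (*-assoc _ _ _))) ⟩
    ∑ (divisors N) (λ k → ⟦ k ∣? d ⟧ * μ (d ÷ k) * (⟦ k ∣? n ⟧ * fromℕ k)) ∎

  -- Writing d = kt turns the interval k ∣ d ∣ D of the divisor lattice into the divisors t of D/k,
  -- where `∑-μ` applies; the interval is empty unless k ∣ D.
  ∑-μ-interval : ∀ {k D} → k ∣ N → D ∣ N →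
    ∑ (divisors N) (λ d → ⟦ k ∣? d ⟧ * (⟦ d ∣? D ⟧ * μ (d ÷ k))) ≈ ⟦ k ℕ.≟ D ⟧
  ∑-μ-interval {k} {D} k∣N D∣N with k ∣? D
  ... | no k∤D = trans
    (∑-zero (divisors N) λ {d} _ → trans
      (⟦⟧-*-cong (k ∣? d) {y = 0#} λ k∣d → ⟦⟧-*-no (d ∣? D) (k∤D ∘ ∣-trans k∣d))
      (zeroʳ _))
    (sym (⟦⟧-no (k ℕ.≟ D) (k∤D ∘ ∣-reflexive)))
  ... | yes k∣D = begin
    ∑ (divisors N) (λ d → ⟦ k ∣? d ⟧ * (⟦ d ∣? D ⟧ * μ (d ÷ k)))
      ≈⟨ ∑-filter² (k ∣?_) (_∣? D) (divisors N) ⟨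
    ∑ (List.filter (_∣? D) (List.filter (k ∣?_) (divisors N))) (λ d → μ (d ÷ k))
      ≈⟨ ∑-reindex (k ℕ.*_) (divisors-unique (D ÷ k))
           (Unique.filter⁺ (_∣? D) (Unique.filter⁺ (k ∣?_) (divisors-unique N)))
           (λ {t} t∈ → let kt∣D = subst (k ℕ.* t ∣_) k*[D÷k]≡D (*-monoʳ-∣ k (∈-divisors⁻ {n = D ÷ k} t∈)) in
             ∈-filter⁺ (_∣? D) (∈-filter⁺ (k ∣?_) (∈-divisors⁺ (∣-trans kt∣D D∣N)) (m∣m*n t)) kt∣D)
           (λ _ _ → ℕ.*-cancelˡ-≡ _ _ k)
           surjective
           (λ d → μ (d ÷ k)) ⟨
    ∑ (divisors (D ÷ k)) (λ t → μ ((k ℕ.* t) ÷ k))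
      ≈⟨ ∑-cong (divisors (D ÷ k)) (λ {t} _ → reflexive (cong μ (m*n÷m k t))) ⟩
    ∑ (divisors (D ÷ k)) μ
      ≈⟨ ∑-μ (D ÷ k) {{÷-nonZero k∣D}} ⟩
    ⟦ (D ÷ k) ℕ.≟ 1 ⟧
      ≈⟨ ⟦⟧-cong ((D ÷ k) ℕ.≟ 1) (k ℕ.≟ D)
           (λ eq → ≡.trans (≡.sym (ℕ.*-identityʳ k)) (≡.trans (cong (k ℕ.*_) (≡.sym eq)) k*[D÷k]≡D))
           (λ { ≡.refl → n÷n k }) ⟩
    ⟦ k ℕ.≟ D ⟧ ∎
    where
    instance
      k≢0 : NonZero k
      k≢0 = ∣-nonZero k∣N
      D≢0 : NonZero D
      D≢0 = ∣-nonZero D∣N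
    k*[D÷k]≡D : k ℕ.* (D ÷ k) ≡ D
    k*[D÷k]≡D = ≡.trans (ℕ.*-comm k (D ÷ k)) (÷-exact k∣D)
    surjective : ∀ {d} → d ∈ List.filter (_∣? D) (List.filter (k ∣?_) (divisors N)) →
                 ∃ λ t → t ∈ divisors (D ÷ k) × d ≡ k ℕ.* t
    surjective d∈ with d∈′ , d∣D ← ∈-filter⁻ (_∣? D) {xs = List.filter (k ∣?_) (divisors N)} d∈
      with _ , divides t ≡.refl ← ∈-filter⁻ (k ∣?_) {xs = divisors N} d∈′
      = t
      , ∈-divisors⁺ {{÷-nonZero k∣D}}
          (*-cancelˡ-∣ k (≡.subst₂ _∣_ (ℕ.*-comm t k) (≡.sym k*[D÷k]≡D) d∣D))
      , ℕ.*-comm t k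

  -- The same inversion with the quotient taken from the upper end. Complementation in N reverses
  -- the divisor lattice and so exchanges the two versions.
  ∑-μ-interval′ : ∀ {d e} → d ∣ N → e ∣ N →
    ∑ (divisors N) (λ k → ⟦ d ∣? k ⟧ * (⟦ k ∣? e ⟧ * μ (e ÷ k))) ≈ ⟦ d ℕ.≟ e ⟧
  ∑-μ-interval′ {d} {e} d∣N e∣N = begin
    ∑ (divisors N) (λ k → ⟦ d ∣? k ⟧ * (⟦ k ∣? e ⟧ * μ (e ÷ k)))
      ≈⟨ ∑-complement _ ⟨
    ∑ (divisors N) (λ k → ⟦ d ∣? (N ÷ k) ⟧ * (⟦ (N ÷ k) ∣? e ⟧ * μ (e ÷ (N ÷ k))))
      ≈⟨ ∑-cong (divisors N) (λ {k} k∈ → term (∈-divisors⁻ k∈)) ⟩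
    ∑ (divisors N) (λ k → ⟦ (N ÷ e) ∣? k ⟧ * (⟦ k ∣? (N ÷ d) ⟧ * μ (k ÷ (N ÷ e))))
      ≈⟨ ∑-μ-interval (÷-∣ e∣N) (÷-∣ d∣N) ⟩
    ⟦ (N ÷ e) ℕ.≟ (N ÷ d) ⟧
      ≈⟨ ⟦⟧-cong ((N ÷ e) ℕ.≟ (N ÷ d)) (d ℕ.≟ e) (≡.sym ∘ ÷-injective e∣N d∣N) (cong (N ÷_) ∘ ≡.sym) ⟩
    ⟦ d ℕ.≟ e ⟧ ∎
    where
    term : ∀ {k} → k ∣ N → ⟦ d ∣? (N ÷ k) ⟧ * (⟦ (N ÷ k) ∣? e ⟧ * μ (e ÷ (N ÷ k))) ≈
                            ⟦ (N ÷ e) ∣? k ⟧ * (⟦ k ∣? (N ÷ d) ⟧ * μ (k ÷ (N ÷ e)))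
    term {k} k∣N = begin
      ⟦ d ∣? (N ÷ k) ⟧ * (⟦ (N ÷ k) ∣? e ⟧ * μ (e ÷ (N ÷ k)))
        ≈⟨ *.x∙yz≈y∙xz _ _ _ ⟩
      ⟦ (N ÷ k) ∣? e ⟧ * (⟦ d ∣? (N ÷ k) ⟧ * μ (e ÷ (N ÷ k)))
        -- The two quotients are compared only when N/k divides e, so this indicator has been moved
        -- to the front.
        ≈⟨ ⟦⟧-*-cong ((N ÷ k) ∣? e) (λ div → *-congˡ (reflexive (cong μ
             (≡.trans (≡.sym (÷-÷-cancel e∣N div)) (cong (_÷ (N ÷ e)) (÷-involutive k∣N)))))) ⟩
      ⟦ (N ÷ k) ∣? e ⟧ * (⟦ d ∣? (N ÷ k) ⟧ * μ (k ÷ (N ÷ e)))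
        ≈⟨ *-cong
             (⟦⟧-cong ((N ÷ k) ∣? e) ((N ÷ e) ∣? k)
               (λ div → subst ((N ÷ e) ∣_) (÷-involutive k∣N) (÷-antitone e∣N div))
               (λ div → subst ((N ÷ k) ∣_) (÷-involutive e∣N) (÷-antitone k∣N div)))
             (*-congʳ (⟦⟧-cong (d ∣? (N ÷ k)) (k ∣? (N ÷ d))
               (λ div → subst (_∣ (N ÷ d)) (÷-involutive k∣N) (÷-antitone (÷-∣ k∣N) div))
               (λ div → subst (_∣ (N ÷ k)) (÷-involutive d∣N) (÷-antitone (÷-∣ d∣N) div)))) ⟩
      ⟦ (N ÷ e) ∣? k ⟧ * (⟦ k ∣? (N ÷ d) ⟧ * μ (k ÷ (N ÷ e))) ∎

  ramanujanKernel : Kernel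
  ramanujanKernel n d = ramanujan d n

  -- By `ramanujan-expansion`, c(·, n) is the Möbius transform of k ↦ k [k ∣ n]; summing over the
  -- divisors of D undoes it, by `∑-μ-interval`.
  ∑-ramanujan : ∀ {D} n → D ∣ N →
    ∑ (divisors N) (λ d → ⟦ d ∣? D ⟧ * ramanujan d n) ≈ ⟦ D ∣? n ⟧ * fromℕ D
  ∑-ramanujan {D} n D∣N = begin
    ∑ (divisors N) (λ d → ⟦ d ∣? D ⟧ * ramanujan d n)
      ≈⟨ ∑-cong (divisors N) (λ {d} d∈ → trans
           (*-congˡ (ramanujan-expansion n (∈-divisors⁻ d∈)))
           (*-∑ (divisors N) ⟦ d ∣? D ⟧)) ⟩
    ∑ (divisors N) (λ d → ∑ (divisors N) (λ k → ⟦ d ∣? D ⟧ * (⟦ k ∣? d ⟧ * μ (d ÷ k) * g k)))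
      ≈⟨ ∑-swap (divisors N) (divisors N) ⟩
    ∑ (divisors N) (λ k → ∑ (divisors N) (λ d → ⟦ d ∣? D ⟧ * (⟦ k ∣? d ⟧ * μ (d ÷ k) * g k)))
      ≈⟨ ∑-cong (divisors N) (λ {k} k∈ → trans
           (∑-cong (divisors N) (λ _ → trans (sym (*-assoc _ _ _)) (*-congʳ (*.x∙yz≈y∙xz _ _ _))))
           (trans (sym (∑-* (divisors N) (g k))) (*-congʳ (∑-μ-interval (∈-divisors⁻ k∈) D∣N)))) ⟩
    ∑ (divisors N) (λ k → ⟦ k ℕ.≟ D ⟧ * g k)
      ≈⟨ ∑-singleton (λ k → ⟦ k ℕ.≟ D ⟧ * g k) (divisors-unique N) (∈-divisors⁺ D∣N)
           (λ {k} _ k≢D → ⟦⟧-*-no (k ℕ.≟ D) k≢D) ⟩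
    ⟦ D ℕ.≟ D ⟧ * g D
      ≈⟨ ⟦⟧-*-yes (D ℕ.≟ D) ≡.refl ⟩
    g D ∎
    where
    g : ℕ → Carrier
    g k = ⟦ k ∣? n ⟧ * fromℕ k

  ramanujan-codivisibility : ∀ {n D} → D ∣ N →
    ∑ (divisors N) (λ d → ramanujanKernel n d * codivisibilityKernel N (N ÷ d) D) ≈ divisibilityKernel N n D
  ramanujan-codivisibility {n} {D} D∣N = begin
    ∑ (divisors N) (λ d → ramanujan d n * (1/ N * (fromℕ (N ÷ D) * ⟦ (N ÷ D) ∣? (N ÷ d) ⟧)))
      ≈⟨ ∑-cong (divisors N) (λ {d} d∈ → trans (*-comm _ _) (trans (*-congʳ (trans (sym (*-assoc _ _ _))
           (*-congˡ (⟦⟧-cong ((N ÷ D) ∣? (N ÷ d)) (d ∣? D)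
             (÷-antitone⁻¹ (∈-divisors⁻ d∈) D∣N) (÷-antitone D∣N))))) (*-assoc _ _ _))) ⟩
    ∑ (divisors N) (λ d → 1/ N * fromℕ (N ÷ D) * (⟦ d ∣? D ⟧ * ramanujan d n))
      ≈⟨ *-∑ (divisors N) _ ⟨
    1/ N * fromℕ (N ÷ D) * ∑ (divisors N) (λ d → ⟦ d ∣? D ⟧ * ramanujan d n)
      ≈⟨ *-congˡ (trans (∑-ramanujan n D∣N) (*-comm _ _)) ⟩
    1/ N * fromℕ (N ÷ D) * (fromℕ D * ⟦ D ∣? n ⟧)
      ≈⟨ trans (sym (*-assoc _ _ _)) (*-congʳ (1/-*-÷ N D∣N)) ⟩
    1# * ⟦ D ∣? n ⟧
      ≈⟨ *-identityˡ _ ⟩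
    ⟦ D ∣? n ⟧ ∎

  -- Extracts the Fourier coefficient at the frequency N/d.
  inverseRamanujanKernel : Kernel
  inverseRamanujanKernel d n = inverseFourierKernel N (N ÷ d) n

  -- The Fourier coefficients of k [k ∣ n] are the indicator of the multiples of N/k, and N/k ∣ N/d
  -- means d ∣ k.
  ∑-inverseFourier-divisibility : ∀ {d k} → d ∣ N → k ∣ N →
    ∑ (range⁺ N) (λ n → inverseRamanujanKernel d n * (⟦ k ∣? n ⟧ * fromℕ k)) ≈ ⟦ d ∣? k ⟧
  ∑-inverseFourier-divisibility {d} {k} d∣N k∣N = begin
    ∑ (range⁺ N) (λ n → I n * (⟦ k ∣? n ⟧ * fromℕ k))
      ≈⟨ ∑-cong (range⁺ N) (λ {n} _ → trans (*-congˡ (sym (∑-e-multiples N n k∣N))) (*-∑ (range⁺ N) (I n))) ⟩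
    ∑ (range⁺ N) (λ n → ∑ (range⁺ N) (λ l → I n * (⟦ (N ÷ k) ∣? l ⟧ * e N (n ℕ.* l))))
      ≈⟨ ∑-swap (range⁺ N) (range⁺ N) ⟩
    ∑ (range⁺ N) (λ l → ∑ (range⁺ N) (λ n → I n * (⟦ (N ÷ k) ∣? l ⟧ * e N (n ℕ.* l))))
      ≈⟨ ∑-cong (range⁺ N) (λ {l} l∈ → trans
           (∑-cong (range⁺ N) (λ _ → *.x∙yz≈y∙xz _ _ _))
           (trans (sym (*-∑ (range⁺ N) ⟦ (N ÷ k) ∣? l ⟧)) (*-congˡ (inverseFourier-fourier N N÷d∈ l∈)))) ⟩
    ∑ (range⁺ N) (λ l → ⟦ (N ÷ k) ∣? l ⟧ * ⟦ (N ÷ d) ℕ.≟ l ⟧)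
      ≈⟨ ∑-singleton _ (range⁺-unique N) N÷d∈
           (λ {l} _ l≢ → trans (*-congˡ (⟦⟧-no ((N ÷ d) ℕ.≟ l) (l≢ ∘ ≡.sym))) (zeroʳ _)) ⟩
    ⟦ (N ÷ k) ∣? (N ÷ d) ⟧ * ⟦ (N ÷ d) ℕ.≟ (N ÷ d) ⟧
      ≈⟨ trans (*-congˡ (⟦⟧-yes ((N ÷ d) ℕ.≟ (N ÷ d)) ≡.refl)) (*-identityʳ _) ⟩
    ⟦ (N ÷ k) ∣? (N ÷ d) ⟧
      ≈⟨ ⟦⟧-cong ((N ÷ k) ∣? (N ÷ d)) (d ∣? k) (÷-antitone⁻¹ d∣N k∣N) (÷-antitone k∣N) ⟩
    ⟦ d ∣? k ⟧ ∎
    where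
    I = inverseRamanujanKernel d
    N÷d∈ : N ÷ d ∈ range⁺ N
    N÷d∈ = ∈-range⁺ {{÷-nonZero d∣N}} (∣⇒≤ (÷-∣ d∣N))

  -- Expanding c(e, n) into divisibility indicators leaves ∑ [d ∣ k] [k ∣ e] μ(e/k) over k. Here μ
  -- is taken at a quotient of the upper end e, hence `∑-μ-interval′`.
  inverseRamanujan-ramanujan : ∀ {d e} → d ∈ divisors N → e ∈ divisors N →
    ∑ (range⁺ N) (λ n → inverseRamanujanKernel d n * ramanujanKernel n e) ≈ identity d e
  inverseRamanujan-ramanujan {d} {e} d∈ e∈ = begin
    ∑ (range⁺ N) (λ n → I n * ramanujan e n)
      ≈⟨ ∑-cong (range⁺ N) (λ {n} _ → trans (*-congˡ (ramanujan-expansion n e∣N)) (*-∑ (divisors N) (I n))) ⟩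
    ∑ (range⁺ N) (λ n → ∑ (divisors N) (λ k → I n * (⟦ k ∣? e ⟧ * μ (e ÷ k) * (⟦ k ∣? n ⟧ * fromℕ k))))
      ≈⟨ ∑-swap (range⁺ N) (divisors N) ⟩
    ∑ (divisors N) (λ k → ∑ (range⁺ N) (λ n → I n * (⟦ k ∣? e ⟧ * μ (e ÷ k) * (⟦ k ∣? n ⟧ * fromℕ k))))
      ≈⟨ ∑-cong (divisors N) (λ {k} k∈ → trans
           (∑-cong (range⁺ N) (λ _ → *.x∙yz≈y∙xz _ _ _))
           (trans (sym (*-∑ (range⁺ N) (⟦ k ∣? e ⟧ * μ (e ÷ k))))
             (trans (*-congˡ (∑-inverseFourier-divisibility d∣N (∈-divisors⁻ k∈))) (*-comm _ _)))) ⟩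
    ∑ (divisors N) (λ k → ⟦ d ∣? k ⟧ * (⟦ k ∣? e ⟧ * μ (e ÷ k)))
      ≈⟨ ∑-μ-interval′ d∣N e∣N ⟩
    ⟦ d ℕ.≟ e ⟧ ∎
    where
    I = inverseRamanujanKernel d
    d∣N = ∈-divisors⁻ {n = N} d∈
    e∣N = ∈-divisors⁻ {n = N} e∈

-- Normal form of S

module NormalForm {c ℓ₁ ℓ₂} (ℂ : ComplexExponentialField c ℓ₁ ℓ₂) (N : ℕ) .{{N≢0 : NonZero N}} where

  open Arithmetic ℂ
  open Sums ℂ
  open Transforms ℂ
  open FourierKernels ℂ
  open import Relation.Binary.Reasoning.Setoid setoid

  ⟨/⟩-∤ : ∀ (f : ArithmeticFunction) {x y} → ¬ y ∣ x → f ⟨ x / y ⟩ ≈ 0#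
  ⟨/⟩-∤ f {x} {y} y∤x with y ∣? x
  ... | yes y∣x = contradiction y∣x y∤x
  ... | no _    = refl

  divides? : ∀ {m} (Ds ns : Vec ℕ m) → Dec (Pointwise _∣_ Ds ns)
  divides? = Pointwise.decidable _∣?_

  ⟦divides?⟧-∷ : ∀ {m} D n (Ds ns : Vec ℕ m) →
                 ⟦ divides? (D ∷ Ds) (n ∷ ns) ⟧ ≈ ⟦ D ∣? n ⟧ * ⟦ divides? Ds ns ⟧
  ⟦divides?⟧-∷ D n Ds ns = sym (⟦⟧-* (D ∣? n)
    (λ D∣n → ⟦⟧-cong (divides? Ds ns) (divides? (D ∷ Ds) (n ∷ ns)) (D∣n ∷_) Pointwise.tail)
    (λ D∤n → ⟦⟧-no (divides? (D ∷ Ds) (n ∷ ns)) (D∤n ∘ Pointwise.head)))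

  -- Confines each Dⱼ to the divisors of N; `∑-powers` consumes this factor when it passes from the
  -- roots d to the powers D.
  dividesN : ∀ {m} → Vec ℕ m → Carrier
  dividesN Ds = ∏ (Vec.map (λ D → ⟦ D ∣? N ⟧) Ds)

  -- On a nonvanishing chain each Dⱼ divides Dⱼ₋₁, which divides N and all earlier nᵢ.
  chain-gcds : ∀ {m} (g : Vec ArithmeticFunction (ℕ.suc m)) {x y} → x ∣ y → x ∣ N → (Ds ns : Vec ℕ m) →
    ⟦ divides? Ds (gcds y ns) ⟧ * chain g x Ds ≈
    dividesN Ds * (chain g x Ds * ∏ (Vec.zipWith (divisibilityKernel N) ns Ds))
  chain-gcds (g ∷ []) x∣y x∣N [] [] = *-congˡ (sym (*-identityʳ _))
  chain-gcds (g ∷ gs@(_ ∷ _)) {x} {y} x∣y x∣N (D ∷ Ds) (n ∷ ns) = cases (D ∣? x) (D ∣? n)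
    where
    g⟨x/D⟩ = g ⟨ x / D ⟩
    C = chain gs D Ds
    K = ∏ (Vec.zipWith (divisibilityKernel N) ns Ds)
    cases : Dec (D ∣ x) → Dec (D ∣ n) →
      ⟦ divides? (D ∷ Ds) (gcds y (n ∷ ns)) ⟧ * (g⟨x/D⟩ * C) ≈
      dividesN (D ∷ Ds) * (g⟨x/D⟩ * C * (⟦ D ∣? n ⟧ * K))
    cases (no D∤x) _ = trans
      (trans (*-congˡ (trans (*-congʳ (⟨/⟩-∤ g D∤x)) (zeroˡ _))) (zeroʳ _))
      (sym (trans (*-congˡ (trans (*-congʳ (trans (*-congʳ (⟨/⟩-∤ g D∤x)) (zeroˡ _))) (zeroˡ _))) (zeroʳ _)))
    cases (yes _) (no D∤n) = trans
      (⟦⟧-*-no (divides? (D ∷ Ds) (gcds y (n ∷ ns)))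
        (D∤n ∘ λ D∣ → ∣-trans (Pointwise.head D∣) (gcd[m,n]∣n y n)))
      (sym (trans (*-congˡ (trans (*-congˡ (⟦⟧-*-no (D ∣? n) D∤n)) (zeroʳ _))) (zeroʳ _)))
    cases (yes D∣x) (yes D∣n) = begin
      ⟦ divides? (D ∷ Ds) (gcd y n ∷ gcds (gcd y n) ns) ⟧ * (g⟨x/D⟩ * C)
        ≈⟨ *-congʳ (trans (⟦divides?⟧-∷ D (gcd y n) Ds (gcds (gcd y n) ns)) (⟦⟧-*-yes (D ∣? gcd y n) D∣gcd)) ⟩
      ⟦ divides? Ds (gcds (gcd y n) ns) ⟧ * (g⟨x/D⟩ * C)
        ≈⟨ *.x∙yz≈y∙xz _ _ _ ⟩
      g⟨x/D⟩ * (⟦ divides? Ds (gcds (gcd y n) ns) ⟧ * C)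
        -- D ∣ gcd(y, n) is the invariant x ∣ y for the rest of the chain: the current entry divides
        -- the running gcd.
        ≈⟨ *-congˡ (chain-gcds gs D∣gcd (∣-trans D∣x x∣N) Ds ns) ⟩
      g⟨x/D⟩ * (dividesN Ds * (C * K))
        ≈⟨ trans (*.x∙yz≈y∙xz _ _ _) (*-congˡ (sym (*-assoc _ _ _))) ⟩
      dividesN Ds * (g⟨x/D⟩ * C * K)
        ≈⟨ *-cong (⟦⟧-*-yes (D ∣? N) (∣-trans D∣x x∣N)) (*-congˡ (⟦⟧-*-yes (D ∣? n) D∣n)) ⟨
      dividesN (D ∷ Ds) * (g⟨x/D⟩ * C * ∏ (Vec.zipWith (divisibilityKernel N) (n ∷ ns) (D ∷ Ds))) ∎
      where
      D∣gcd : D ∣ gcd y n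
      D∣gcd = gcd-greatest (∣-trans D∣x x∣y) D∣n

  -- For γ > 0 the map d ↦ d^γ is a bijection from the d ≤ N with d^γ ∣ N onto the γ-th powers among
  -- the divisors of N.
  ∑-powers₁ : ∀ γ .{{_ : NonZero γ}} (h : ℕ → Carrier) →
    ∑ (range⁺ N) (λ d → ⟦ (d ℕ.^ γ) ∣? N ⟧ * h (d ℕ.^ γ)) ≈
    ∑ (divisors N) (λ D → powerIndicator γ D * h D)
  ∑-powers₁ γ h = begin
    ∑ (range⁺ N) (λ d → ⟦ (d ℕ.^ γ) ∣? N ⟧ * h (d ℕ.^ γ))
      ≈⟨ ∑-filter power∣? (range⁺ N) ⟨
    ∑ (List.filter power∣? (range⁺ N)) (λ d → h (d ℕ.^ γ))
      ≈⟨ ∑-reindex (ℕ._^ γ) (Unique.filter⁺ power∣? (range⁺-unique N))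
           (Unique.filter⁺ isPower? (divisors-unique N))
           (λ {d} d∈ → let d∈range , d^γ∣N = ∈-filter⁻ power∣? {xs = range⁺ N} d∈
                           d≢0 = proj₁ (∈-range⁻ d∈range) in
             ∈-filter⁺ isPower? (∈-divisors⁺ d^γ∣N)
               -- `powerIndicator` looks for a root of D in {1,...,D}, and d ≤ d^γ puts d there.
               (lose (∈-range⁺ {{d≢0}} (m≤m^n d γ {{d≢0}})) ≡.refl))
           (λ _ _ → ^-injectiveˡ γ)
           surjective
           h ⟩
    ∑ (List.filter isPower? (divisors N)) h
      ≈⟨ ∑-filter isPower? (divisors N) ⟩
    ∑ (divisors N) (λ D → powerIndicator γ D * h D) ∎
    where
    power∣? = λ d → (d ℕ.^ γ) ∣? N
    isPower? = λ D → any? (λ k → k ℕ.^ γ ℕ.≟ D) (range⁺ D)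
    surjective : ∀ {D} → D ∈ List.filter isPower? (divisors N) →
                 ∃ λ d → d ∈ List.filter power∣? (range⁺ N) × D ≡ d ℕ.^ γ
    surjective D∈ with D∈divisors , power ← ∈-filter⁻ isPower? {xs = divisors N} D∈
      with d , d∈ , ≡.refl ← find power =
      let D∣N = ∈-divisors⁻ {n = N} D∈divisors
          d≢0 , d≤D = ∈-range⁻ d∈
      in d , ∈-filter⁺ power∣? (∈-range⁺ {{d≢0}} (ℕ.≤-trans d≤D (∣⇒≤ D∣N))) D∣N , ≡.refl

  ∑-powers : ∀ {m} (γ : Vec ℕ m) → All NonZero γ → (G : Vec ℕ m → Carrier) →
    ∑ (tuples m (range⁺ N)) (λ d → dividesN (Vec.zipWith ℕ._^_ d γ) * G (Vec.zipWith ℕ._^_ d γ)) ≈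
    ∑ (tuples m (divisors N)) (λ D → ∏ (Vec.zipWith powerIndicator γ D) * G D)
  ∑-powers [] [] G = refl
  ∑-powers {ℕ.suc m} (γ ∷ γs) (γ≢0 ∷ γs≢0) G = begin
    ∑ (tuples (ℕ.suc m) (range⁺ N)) (λ d →
      dividesN (Vec.zipWith ℕ._^_ d (γ ∷ γs)) * G (Vec.zipWith ℕ._^_ d (γ ∷ γs)))
      ≈⟨ ∑-cartesianProductWith _∷_ (range⁺ N) (tuples m (range⁺ N)) ⟩
    ∑ (range⁺ N) (λ d → ∑ (tuples m (range⁺ N)) (λ ds →
      ⟦ (d ℕ.^ γ) ∣? N ⟧ * dividesN (Vec.zipWith ℕ._^_ ds γs) * G (d ℕ.^ γ ∷ Vec.zipWith ℕ._^_ ds γs)))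
      ≈⟨ ∑-cong (range⁺ N) (λ {d} _ → trans
           (∑-cong (tuples m (range⁺ N)) (λ _ → *-assoc _ _ _))
           (trans (sym (*-∑ (tuples m (range⁺ N)) ⟦ (d ℕ.^ γ) ∣? N ⟧))
             (*-congˡ (∑-powers γs γs≢0 (λ Ds → G (d ℕ.^ γ ∷ Ds)))))) ⟩
    ∑ (range⁺ N) (λ d → ⟦ (d ℕ.^ γ) ∣? N ⟧ * H (d ℕ.^ γ))
      ≈⟨ ∑-powers₁ γ {{γ≢0}} H ⟩
    ∑ (divisors N) (λ D → powerIndicator γ D * H D)
      ≈⟨ ∑-cong (divisors N) (λ {D} _ → trans (*-∑ (tuples m (divisors N)) (powerIndicator γ D))
           (∑-cong (tuples m (divisors N)) (λ _ → sym (*-assoc _ _ _)))) ⟩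
    ∑ (divisors N) (λ D → ∑ (tuples m (divisors N)) (λ Ds →
      powerIndicator γ D * ∏ (Vec.zipWith powerIndicator γs Ds) * G (D ∷ Ds)))
      ≈⟨ ∑-cartesianProductWith _∷_ (divisors N) (tuples m (divisors N)) ⟨
    ∑ (tuples (ℕ.suc m) (divisors N)) (λ D → ∏ (Vec.zipWith powerIndicator (γ ∷ γs) D) * G D) ∎
    where
    H : ℕ → Carrier
    H D = ∑ (tuples m (divisors N)) (λ Ds → ∏ (Vec.zipWith powerIndicator γs Ds) * G (D ∷ Ds))

  weight : ∀ {m} → Vec ℕ m → (Vec ℕ m → Carrier) → Vec ArithmeticFunction (ℕ.suc m) → Vec ℕ m → Carrier
  weight γ η g D = ∏ (Vec.zipWith powerIndicator γ D) * (η D * chain g N D)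

  S-transform : ∀ {m} (γ : Vec ℕ m) → All NonZero γ → ∀ η (g : Vec ArithmeticFunction (ℕ.suc m)) ns →
                S γ η g N ns ≈ transform (divisors N) (divisibilityKernel N) (weight γ η g) ns
  S-transform {m} γ γ≢0 η g ns = begin
    S γ η g N ns
      ≈⟨ ∑-filter (λ d → divides? (powers d) (gcds N ns)) (tuples m (range⁺ N)) ⟩
    ∑ (tuples m (range⁺ N)) (λ d →
      ⟦ divides? (powers d) (gcds N ns) ⟧ * (η (powers d) * chain g N (powers d)))
      ≈⟨ ∑-cong (tuples m (range⁺ N)) (λ {d} _ → trans (*.x∙yz≈y∙xz _ _ _)
           (trans (*-congˡ (chain-gcds g ∣-refl ∣-refl (powers d) ns)) (*.x∙yz≈y∙xz _ _ _))) ⟩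
    ∑ (tuples m (range⁺ N)) (λ d → dividesN (powers d) * G (powers d))
      ≈⟨ ∑-powers γ γ≢0 G ⟩
    ∑ (tuples m (divisors N)) (λ D → ∏ (Vec.zipWith powerIndicator γ D) * G D)
      ≈⟨ ∑-cong (tuples m (divisors N)) (λ _ → trans (*-congˡ (sym (*-assoc _ _ _))) (sym (*-assoc _ _ _))) ⟩
    transform (divisors N) (divisibilityKernel N) (weight γ η g) ns ∎
    where
    powers : Vec ℕ m → Vec ℕ m
    powers d = Vec.zipWith ℕ._^_ d γ
    G : Vec ℕ m → Carrier
    G D = η D * (chain g N D * ∏ (Vec.zipWith (divisibilityKernel N) ns D))

-- Transposition

module _ {a} {A : Set a} where

  -- `transposeᶠ` reverses f through indices, whereas the chains are reversed by recursion on
  -- vectors.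
  tabulate-opposite : ∀ {m} (xs : Vec A m) → Vec.tabulate (Vec.lookup xs ∘ opposite) ≡ Vec.reverse xs
  tabulate-opposite []       = ≡.refl
  tabulate-opposite (x ∷ xs) = ≡.trans (snoc x xs)
    (≡.trans (cong (_∷ʳ x) (tabulate-opposite xs)) (≡.sym (Vec.reverse-∷ x xs)))
    where
    tabulate-∷ʳ : ∀ {m} (h : Fin (ℕ.suc m) → A) →
                  Vec.tabulate h ≡ Vec.tabulate (h ∘ inject₁) ∷ʳ h (Fin.fromℕ m)
    tabulate-∷ʳ {ℕ.zero}  h = ≡.refl
    tabulate-∷ʳ {ℕ.suc m} h = cong (h Fin.zero ∷_) (tabulate-∷ʳ (h ∘ Fin.suc))
    opposite-fromℕ : ∀ m → opposite (Fin.fromℕ m) ≡ Fin.zero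
    opposite-fromℕ ℕ.zero    = ≡.refl
    opposite-fromℕ (ℕ.suc m) = cong inject₁ (opposite-fromℕ m)
    opposite-inject₁ : ∀ {m} (i : Fin m) → opposite (inject₁ i) ≡ Fin.suc (opposite i)
    opposite-inject₁ Fin.zero    = ≡.refl
    opposite-inject₁ (Fin.suc i) = cong inject₁ (opposite-inject₁ i)
    snoc : ∀ {m} x (xs : Vec A m) → Vec.tabulate (Vec.lookup (x ∷ xs) ∘ opposite) ≡
                                     Vec.tabulate (Vec.lookup xs ∘ opposite) ∷ʳ x
    snoc {m} x xs = ≡.trans (tabulate-∷ʳ (Vec.lookup (x ∷ xs) ∘ opposite))
      (cong₂ _∷ʳ_ (Vec.tabulate-cong (cong (Vec.lookup (x ∷ xs)) ∘ opposite-inject₁))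
                  (cong (Vec.lookup (x ∷ xs)) (opposite-fromℕ m)))

zipWith-reverse : ∀ {a b c} {A : Set a} {B : Set b} {C : Set c} (f : A → B → C)
                  {m} (xs : Vec A m) (ys : Vec B m) →
                  Vec.zipWith f (Vec.reverse xs) (Vec.reverse ys) ≡ Vec.reverse (Vec.zipWith f xs ys)
zipWith-reverse f []       []       = ≡.refl
zipWith-reverse f (x ∷ xs) (y ∷ ys) = begin
  Vec.zipWith f (Vec.reverse (x ∷ xs)) (Vec.reverse (y ∷ ys))
    ≡⟨ cong₂ (Vec.zipWith f) (Vec.reverse-∷ x xs) (Vec.reverse-∷ y ys) ⟩
  Vec.zipWith f (Vec.reverse xs ∷ʳ x) (Vec.reverse ys ∷ʳ y)
    ≡⟨ zipWith-∷ʳ (Vec.reverse xs) (Vec.reverse ys) ⟩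
  Vec.zipWith f (Vec.reverse xs) (Vec.reverse ys) ∷ʳ f x y
    ≡⟨ cong (_∷ʳ f x y) (zipWith-reverse f xs ys) ⟩
  Vec.reverse (Vec.zipWith f xs ys) ∷ʳ f x y
    ≡⟨ Vec.reverse-∷ (f x y) (Vec.zipWith f xs ys) ⟨
  Vec.reverse (Vec.zipWith f (x ∷ xs) (y ∷ ys)) ∎
  where
  open ≡.≡-Reasoning
  zipWith-∷ʳ : ∀ {m} (xs : Vec _ m) (ys : Vec _ m) →
               Vec.zipWith f (xs ∷ʳ x) (ys ∷ʳ y) ≡ Vec.zipWith f xs ys ∷ʳ f x y
  zipWith-∷ʳ []        []        = ≡.refl
  zipWith-∷ʳ (x′ ∷ xs) (y′ ∷ ys) = cong (f x′ y′ ∷_) (zipWith-∷ʳ xs ys)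

All-∷ʳ : ∀ {a p} {A : Set a} {P : A → Set p} {m x} {xs : Vec A m} → All P xs → P x → All P (xs ∷ʳ x)
All-∷ʳ []         px = px ∷ []
All-∷ʳ (py ∷ pxs) px = py ∷ All-∷ʳ pxs px

All-reverse : ∀ {a p} {A : Set a} {P : A → Set p} {m} {xs : Vec A m} → All P xs → All P (Vec.reverse xs)
All-reverse []                          = []
All-reverse {xs = x ∷ xs} (px ∷ pxs) =
  subst (All _) (≡.sym (Vec.reverse-∷ x xs)) (All-∷ʳ (All-reverse pxs) px)

^-distribʳ-* : ∀ k m n → (m ℕ.* n) ℕ.^ k ≡ m ℕ.^ k ℕ.* n ℕ.^ k
^-distribʳ-* ℕ.zero    m n = ≡.refl
^-distribʳ-* (ℕ.suc k) m n = ≡.trans (cong (m ℕ.* n ℕ.*_) (^-distribʳ-* k m n))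
                                     (interchange m n (m ℕ.^ k) (n ℕ.^ k))
  where open CommutativeSemigroupProperties ℕ.*-commutativeSemigroup using (interchange)

-- This is the substitution made inside `transposeʷ`, so evaluating `transposeʷ` at a complement
-- restores the original tuple of divisors.
complement : ∀ {m} → ℕ → Vec ℕ m → Vec ℕ m
complement n Ds = Vec.map (n ÷_) (Vec.reverse Ds)

module _ {n} .{{_ : NonZero n}} where

  All-complement : ∀ {m} {Ds : Vec ℕ m} → All (_∣ n) Ds → All (_∣ n) (complement n Ds)
  All-complement Ds∣n = All.map⁺ (All.map ÷-∣ (All-reverse Ds∣n))

  complement-involutive : ∀ {m} {Ds : Vec ℕ m} → All (_∣ n) Ds → complement n (complement n Ds) ≡ Ds
  complement-involutive {Ds = Ds} Ds∣n = begin
    Vec.map (n ÷_) (Vec.reverse (Vec.map (n ÷_) (Vec.reverse Ds)))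
      ≡⟨ cong (Vec.map (n ÷_)) (Vec.map-reverse (n ÷_) (Vec.reverse Ds)) ⟨
    Vec.map (n ÷_) (Vec.map (n ÷_) (Vec.reverse (Vec.reverse Ds)))
      ≡⟨ cong (Vec.map (n ÷_) ∘ Vec.map (n ÷_)) (Vec.reverse-involutive Ds) ⟩
    Vec.map (n ÷_) (Vec.map (n ÷_) Ds)
      ≡⟨ map-÷-involutive Ds∣n ⟩
    Ds ∎
    where
    open ≡.≡-Reasoning
    map-÷-involutive : ∀ {m} {Ds : Vec ℕ m} → All (_∣ n) Ds → Vec.map (n ÷_) (Vec.map (n ÷_) Ds) ≡ Ds
    map-÷-involutive []            = ≡.refl
    map-÷-involutive (D∣n ∷ Ds∣n) = cong₂ _∷_ (÷-involutive D∣n) (map-÷-involutive Ds∣n)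

module Transposition {c ℓ₁ ℓ₂} (ℂ : ComplexExponentialField c ℓ₁ ℓ₂) (N : ℕ) .{{N≢0 : NonZero N}} where

  open Arithmetic ℂ
  open Sums ℂ
  open Exponentials ℂ
  open NormalForm ℂ N
  open import Relation.Binary.Reasoning.Setoid setoid

  ∏-reverse : ∀ {m} (xs : Vec Carrier m) → ∏ (Vec.reverse xs) ≈ ∏ xs
  ∏-reverse []       = refl
  ∏-reverse (x ∷ xs) = begin
    ∏ (Vec.reverse (x ∷ xs))    ≈⟨ reflexive (cong ∏ (Vec.reverse-∷ x xs)) ⟩
    ∏ (Vec.reverse xs ∷ʳ x)     ≈⟨ ∏-∷ʳ (Vec.reverse xs) x ⟩
    x * ∏ (Vec.reverse xs)      ≈⟨ *-congˡ (∏-reverse xs) ⟩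
    x * ∏ xs                    ∎
    where
    ∏-∷ʳ : ∀ {m} (xs : Vec Carrier m) x → ∏ (xs ∷ʳ x) ≈ x * ∏ xs
    ∏-∷ʳ []       x = refl
    ∏-∷ʳ (y ∷ xs) x = trans (*-congˡ (∏-∷ʳ xs x)) (*.x∙yz≈y∙xz _ _ _)

  ⟨/⟩-∣ : ∀ (f : ArithmeticFunction) {x y} → y ∣ x → f ⟨ x / y ⟩ ≈ f (x ÷ y)
  ⟨/⟩-∣ f {x} {y} y∣x with y ∣? x
  ... | yes _  = refl
  ... | no y∤x = contradiction y∣x y∤x

  -- The two fractions are equal, and complementation reflects divisibility, so they also fail to be
  -- integers simultaneously.
  ⟨/⟩-complement : ∀ (f : ArithmeticFunction) {x y} → x ∣ N → y ∣ N → f ⟨ (N ÷ y) / (N ÷ x) ⟩ ≈ f ⟨ x / y ⟩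
  ⟨/⟩-complement f {x} {y} x∣N y∣N = cases (y ∣? x)
    where
    cases : Dec (y ∣ x) → f ⟨ (N ÷ y) / (N ÷ x) ⟩ ≈ f ⟨ x / y ⟩
    cases (yes y∣x) = trans (⟨/⟩-∣ f (÷-antitone x∣N y∣x))
                            (trans (reflexive (cong f (÷-÷-cancel x∣N y∣x))) (sym (⟨/⟩-∣ f y∣x)))
    cases (no y∤x)  = trans (⟨/⟩-∤ f (y∤x ∘ ÷-antitone⁻¹ y∣N x∣N)) (sym (⟨/⟩-∤ f y∤x))

  -- The chain with a general right end y in place of 1, which makes it symmetric under reversal.
  chainTo : ∀ {m} → Vec ArithmeticFunction (ℕ.suc m) → ℕ → Vec ℕ m → ℕ → Carrier
  chainTo (g ∷ [])         x []       y = g ⟨ x / y ⟩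
  chainTo (g ∷ gs@(_ ∷ _)) x (D ∷ Ds) y = g ⟨ x / D ⟩ * chainTo gs D Ds y

  chainTo-1 : ∀ {m} (g : Vec ArithmeticFunction (ℕ.suc m)) x Ds → chainTo g x Ds 1 ≈ chain g x Ds
  chainTo-1 (g ∷ [])         x []       = trans (⟨/⟩-∣ g (1∣ x)) (reflexive (cong g (n÷1 x)))
  chainTo-1 (g ∷ gs@(_ ∷ _)) x (D ∷ Ds) = *-congˡ (chainTo-1 gs D Ds)

  chainTo-∷ʳ : ∀ {m} (gs : Vec ArithmeticFunction (ℕ.suc m)) g x Ds z y →
               chainTo (gs ∷ʳ g) x (Ds ∷ʳ z) y ≈ chainTo gs x Ds z * g ⟨ z / y ⟩
  chainTo-∷ʳ (h ∷ [])         g x []       z y = refl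
  chainTo-∷ʳ (h ∷ gs@(_ ∷ _)) g x (D ∷ Ds) z y =
    trans (*-congˡ (chainTo-∷ʳ gs g D Ds z y)) (sym (*-assoc _ _ _))

  -- The first link, from x to D, becomes the last link of the complemented chain, from N/D to N/x;
  -- the rest is the induction hypothesis.
  chainTo-reverse : ∀ {m} (fs : Vec ArithmeticFunction (ℕ.suc m)) {x y Ds} → x ∣ N → y ∣ N → All (_∣ N) Ds →
                    chainTo (Vec.reverse fs) (N ÷ y) (complement N Ds) (N ÷ x) ≈ chainTo fs x Ds y
  chainTo-reverse (f ∷ [])         {Ds = []} x∣N y∣N [] = ⟨/⟩-complement f x∣N y∣N
  chainTo-reverse (f ∷ fs@(_ ∷ _)) {x} {y} {D ∷ Ds} x∣N y∣N (D∣N ∷ Ds∣N) = begin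
    chainTo (Vec.reverse (f ∷ fs)) (N ÷ y) (complement N (D ∷ Ds)) (N ÷ x)
      ≈⟨ reflexive (cong₂ (λ gs Ds → chainTo gs (N ÷ y) Ds (N ÷ x)) (Vec.reverse-∷ f fs)
           (≡.trans (cong (Vec.map (N ÷_)) (Vec.reverse-∷ D Ds)) (Vec.map-∷ʳ (N ÷_) D (Vec.reverse Ds)))) ⟩
    chainTo (Vec.reverse fs ∷ʳ f) (N ÷ y) (complement N Ds ∷ʳ (N ÷ D)) (N ÷ x)
      ≈⟨ chainTo-∷ʳ (Vec.reverse fs) f (N ÷ y) (complement N Ds) (N ÷ D) (N ÷ x) ⟩
    chainTo (Vec.reverse fs) (N ÷ y) (complement N Ds) (N ÷ D) * f ⟨ (N ÷ D) / (N ÷ x) ⟩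
      ≈⟨ *-cong (chainTo-reverse fs D∣N y∣N Ds∣N) (⟨/⟩-complement f x∣N D∣N) ⟩
    chainTo fs D Ds y * f ⟨ x / D ⟩
      ≈⟨ *-comm _ _ ⟩
    f ⟨ x / D ⟩ * chainTo fs D Ds y ∎

  chain-reverse : ∀ {m} (f : Vec ArithmeticFunction (ℕ.suc m)) {Ds} → All (_∣ N) Ds →
                  chain (Vec.reverse f) N (complement N Ds) ≈ chain f N Ds
  chain-reverse f {Ds} Ds∣N = begin
    chain (Vec.reverse f) N (complement N Ds)
      ≈⟨ chainTo-1 (Vec.reverse f) N (complement N Ds) ⟨
    chainTo (Vec.reverse f) N (complement N Ds) 1
      -- The ends N and 1 are complements of each other, so the reversed chain has the same ends.
      ≈⟨ reflexive (cong₂ (λ x y → chainTo (Vec.reverse f) x (complement N Ds) y) (n÷1 N) (n÷n N)) ⟨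
    chainTo (Vec.reverse f) (N ÷ 1) (complement N Ds) (N ÷ N)
      ≈⟨ chainTo-reverse f ∣-refl (1∣ N) Ds∣N ⟩
    chainTo f N Ds 1
      ≈⟨ chainTo-1 f N Ds ⟩
    chain f N Ds ∎

  fromℕs : ∀ {m} → Vec ℕ m → Carrier
  fromℕs Ds = ∏ (Vec.map fromℕ Ds)

  -- The powers telescope: (x/D₁)ᵏ (D₁/D₂)ᵏ⁺¹ ⋯ Dₘᵏ⁺ᵐ = xᵏ D₁ ⋯ Dₘ.
  chain-δ : ∀ {m} k (w : Fin (ℕ.suc m) → ℕ) → (∀ i → w i ≡ k ℕ.+ toℕ i) →
            (g : Fin (ℕ.suc m) → ArithmeticFunction) → ∀ x Ds →
            chain (Vec.tabulate λ i n → δ (w i) n * g i n) x Ds ≈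
            fromℕ (x ℕ.^ k) * (fromℕs Ds * chain (Vec.tabulate g) x Ds)
  chain-δ {ℕ.zero} k w w≡ g x [] = *-cong
    (reflexive (cong (λ j → fromℕ (x ℕ.^ j)) (≡.trans (w≡ Fin.zero) (ℕ.+-identityʳ k))))
    (sym (*-identityˡ _))
  chain-δ {ℕ.suc m} k w w≡ g x (D ∷ Ds) = cases (D ∣? x)
    where
    h : ArithmeticFunction
    h n = δ (w Fin.zero) n * g Fin.zero n
    g⟨x/D⟩ = g Fin.zero ⟨ x / D ⟩
    C = chain (Vec.tabulate (g ∘ Fin.suc)) D Ds
    power : D ∣ x → fromℕ ((x ÷ D) ℕ.^ k) * fromℕ (D ℕ.^ ℕ.suc k) ≈ fromℕ (x ℕ.^ k) * fromℕ D
    power D∣x = trans (sym (fromℕ-* ((x ÷ D) ℕ.^ k) (D ℕ.^ ℕ.suc k)))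
      (trans (reflexive (cong fromℕ (pow D D∣x))) (fromℕ-* (x ℕ.^ k) D))
      where
      pow : ∀ D → D ∣ x → (x ÷ D) ℕ.^ k ℕ.* D ℕ.^ ℕ.suc k ≡ x ℕ.^ k ℕ.* D
      -- `Ds` may contain 0 here; both sides then have a factor 0.
      pow ℕ.zero      _   = ≡.trans (ℕ.*-zeroʳ (0 ℕ.^ k)) (≡.sym (ℕ.*-zeroʳ (x ℕ.^ k)))
      pow D@(ℕ.suc _) (divides q ≡.refl) =
        ≡.trans (cong₂ (λ q′ t → q′ ℕ.^ k ℕ.* t) (m*n÷n q D) (ℕ.*-comm D (D ℕ.^ k)))
          (≡.trans (≡.sym (ℕ.*-assoc (q ℕ.^ k) (D ℕ.^ k) D)) (cong (ℕ._* D) (≡.sym (^-distribʳ-* k q D))))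
    cases : Dec (D ∣ x) →
      h ⟨ x / D ⟩ * chain (Vec.tabulate λ i n → δ (w (Fin.suc i)) n * g (Fin.suc i) n) D Ds ≈
      fromℕ (x ℕ.^ k) * (fromℕ D * fromℕs Ds * (g⟨x/D⟩ * C))
    cases (no D∤x) = trans
      (trans (*-congʳ (⟨/⟩-∤ h D∤x)) (zeroˡ _))
      (sym (trans (*-congˡ (trans (*-congˡ (trans (*-congʳ (⟨/⟩-∤ (g Fin.zero) D∤x)) (zeroˡ _))) (zeroʳ _)))
                  (zeroʳ _)))
    cases (yes D∣x) = begin
      h ⟨ x / D ⟩ * chain (Vec.tabulate λ i n → δ (w (Fin.suc i)) n * g (Fin.suc i) n) D Ds
        ≈⟨ *-cong
             (trans (⟨/⟩-∣ h D∣x) (*-cong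
               (reflexive (cong (λ j → fromℕ ((x ÷ D) ℕ.^ j)) (≡.trans (w≡ Fin.zero) (ℕ.+-identityʳ k))))
               (sym (⟨/⟩-∣ (g Fin.zero) D∣x))))
             (chain-δ (ℕ.suc k) (w ∘ Fin.suc) (λ i → ≡.trans (w≡ (Fin.suc i)) (ℕ.+-suc k (toℕ i)))
               (g ∘ Fin.suc) D Ds) ⟩
      fromℕ ((x ÷ D) ℕ.^ k) * g⟨x/D⟩ * (fromℕ (D ℕ.^ ℕ.suc k) * (fromℕs Ds * C))
        ≈⟨ *.interchange _ _ _ _ ⟩
      fromℕ ((x ÷ D) ℕ.^ k) * fromℕ (D ℕ.^ ℕ.suc k) * (g⟨x/D⟩ * (fromℕs Ds * C))
        ≈⟨ *-cong (power D∣x) (*.x∙yz≈y∙xz _ _ _) ⟩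
      fromℕ (x ℕ.^ k) * fromℕ D * (fromℕs Ds * (g⟨x/D⟩ * C))
        ≈⟨ trans (*-assoc _ _ _) (*-congˡ (sym (*-assoc _ _ _))) ⟩
      fromℕ (x ℕ.^ k) * (fromℕ D * fromℕs Ds * (g⟨x/D⟩ * C)) ∎

  -- Combines the telescoping, started at exponent 0 so that N contributes N⁰ = 1, with the reversal
  -- of the chain. The product of the N/Dⱼ is insensitive to their order.
  chain-transpose : ∀ {m} (f : Vec ArithmeticFunction (ℕ.suc m)) {Ds} → All (_∣ N) Ds →
    chain (transposeᶠ f) N (complement N Ds) ≈ fromℕs (Vec.map (N ÷_) Ds) * chain f N Ds
  chain-transpose f {Ds} Ds∣N = begin
    chain (transposeᶠ f) N (complement N Ds)
      ≈⟨ chain-δ 0 toℕ (λ _ → ≡.refl) (Vec.lookup f ∘ opposite) N (complement N Ds) ⟩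
    fromℕ 1 * (fromℕs (complement N Ds) * chain (Vec.tabulate (Vec.lookup f ∘ opposite)) N (complement N Ds))
      ≈⟨ trans (*-congʳ (+-identityʳ 1#)) (*-identityˡ _) ⟩
    fromℕs (complement N Ds) * chain (Vec.tabulate (Vec.lookup f ∘ opposite)) N (complement N Ds)
      ≈⟨ *-cong
           (trans (reflexive (cong ∏ (≡.trans
             (cong (Vec.map fromℕ) (Vec.map-reverse (N ÷_) Ds)) (Vec.map-reverse fromℕ (Vec.map (N ÷_) Ds)))))
             (∏-reverse (Vec.map fromℕ (Vec.map (N ÷_) Ds))))
           (trans (reflexive (cong (λ g → chain g N (complement N Ds)) (tabulate-opposite f)))
             (chain-reverse f Ds∣N)) ⟩
    fromℕs (Vec.map (N ÷_) Ds) * chain f N Ds ∎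

-- The coefficients, the two expansions and uniqueness

module Coefficients {c ℓ₁ ℓ₂} (ℂ : ComplexExponentialField c ℓ₁ ℓ₂) (N : ℕ) .{{N≢0 : NonZero N}} where

  open Arithmetic ℂ
  open Sums ℂ
  open Transforms ℂ
  open FourierKernels ℂ
  open RamanujanKernels ℂ N
  open NormalForm ℂ N
  open Transposition ℂ N
  open import Relation.Binary.Reasoning.Setoid setoid

  powerIndicator-1 : ∀ D .{{_ : NonZero D}} → powerIndicator 1 D ≈ 1#
  powerIndicator-1 D = ⟦⟧-yes (any? (λ k → k ℕ.^ 1 ℕ.≟ D) (range⁺ D))
    (lose (∈-range⁺ ℕ.≤-refl) (ℕ.^-identityʳ D))

  ∏-powerIndicator-1 : ∀ {m} {Ds : Vec ℕ m} → All (_∣ N) Ds →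
                       ∏ (Vec.zipWith powerIndicator (Vec.replicate m 1) Ds) ≈ 1#
  ∏-powerIndicator-1 []            = refl
  ∏-powerIndicator-1 (D∣N ∷ Ds∣N) =
    trans (*-cong (powerIndicator-1 _ {{∣-nonZero D∣N}}) (∏-powerIndicator-1 Ds∣N)) (*-identityˡ 1#)

  replicate-nonZero : ∀ m → All NonZero (Vec.replicate m 1)
  replicate-nonZero ℕ.zero    = []
  replicate-nonZero (ℕ.suc m) = _ ∷ replicate-nonZero m

  ∈-tuples-divisors⁻ : ∀ m {Ds : Vec ℕ m} → Ds ∈ tuples m (divisors N) → All (_∣ N) Ds
  ∈-tuples-divisors⁻ m = All.map ∈-divisors⁻ ∘ ∈-tuples⁻ m

  ∑-complement-tuples : ∀ m (G : Vec ℕ m → Carrier) →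
    ∑ (tuples m (divisors N)) (G ∘ complement N) ≈ ∑ (tuples m (divisors N)) G
  ∑-complement-tuples m = ∑-reindex (complement N) unique unique complement∈ injective
    (λ {Ds} Ds∈ → complement N Ds , complement∈ Ds∈ , ≡.sym (complement-involutive (∈-tuples-divisors⁻ m Ds∈)))
    where
    unique = tuples-unique m (divisors-unique N)
    complement∈ : ∀ {Ds} → Ds ∈ tuples m (divisors N) → complement N Ds ∈ tuples m (divisors N)
    complement∈ Ds∈ = ∈-tuples⁺ (All.map ∈-divisors⁺ (All-complement (∈-tuples-divisors⁻ m Ds∈)))
    injective : ∀ {Ds Es} → Ds ∈ tuples m (divisors N) → Es ∈ tuples m (divisors N) →
                complement N Ds ≡ complement N Es → Ds ≡ Es
    injective Ds∈ Es∈ eq = ≡.trans (≡.sym (complement-involutive (∈-tuples-divisors⁻ m Ds∈)))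
      (≡.trans (cong (complement N) eq) (complement-involutive (∈-tuples-divisors⁻ m Es∈)))

  -- Sorts the product into the three sources found in `fourierCoeff`: the power n₁⁻ᵐ, the
  -- telescoped factors N/Dⱼ, and the divisibility conditions of S.
  ∏-codivisibility : ∀ {m} (ls Ds : Vec ℕ m) →
    ∏ (Vec.zipWith (codivisibilityKernel N) ls Ds) ≈
    (1/ N) ^ᶜ m * (fromℕs (Vec.map (N ÷_) Ds) * ∏ (Vec.zipWith (divisibilityKernel N) ls (Vec.map (N ÷_) Ds)))
  ∏-codivisibility []       []       = sym (trans (*-identityˡ _) (*-identityˡ 1#))
  ∏-codivisibility {ℕ.suc m} (l ∷ ls) (D ∷ Ds) = begin
    1/ N * (fromℕ (N ÷ D) * ⟦ (N ÷ D) ∣? l ⟧) * ∏ (Vec.zipWith (codivisibilityKernel N) ls Ds)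
      ≈⟨ *-congˡ (∏-codivisibility ls Ds) ⟩
    1/ N * (fromℕ (N ÷ D) * ⟦ (N ÷ D) ∣? l ⟧) * ((1/ N) ^ᶜ m * (_ * _))
      ≈⟨ trans (*.interchange _ _ _ _) (*-congˡ (*.interchange _ _ _ _)) ⟩
    1/ N * (1/ N) ^ᶜ m * (fromℕ (N ÷ D) * fromℕs (Vec.map (N ÷_) Ds) *
      (⟦ (N ÷ D) ∣? l ⟧ * ∏ (Vec.zipWith (divisibilityKernel N) ls (Vec.map (N ÷_) Ds)))) ∎

  module _ {m} (γ : Vec ℕ m) (ξ : Vec ℕ m → Carrier) (f : Vec ArithmeticFunction (suc m)) where

    -- The indicators for the exponents 1 are trivial, and two complementations cancel inside
    -- `transposeʷ`, so ξ and the power indicators are taken at `Ds` itself. Only the factor from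
    -- `chain-transpose` is left.
    weight-transpose : ∀ {Ds} → All (_∣ N) Ds →
      weight (Vec.replicate m 1) (transposeʷ γ ξ N) (transposeᶠ f) (complement N Ds) ≈
      fromℕs (Vec.map (N ÷_) Ds) * weight γ ξ f Ds
    weight-transpose {Ds} Ds∣N = begin
      ∏ (Vec.zipWith powerIndicator (Vec.replicate m 1) (complement N Ds)) *
        (∏ (Vec.zipWith powerIndicator γ q) * ξ q * chain (transposeᶠ f) N (complement N Ds))
        ≈⟨ trans (*-congʳ (∏-powerIndicator-1 (All-complement Ds∣N))) (*-identityˡ _) ⟩
      ∏ (Vec.zipWith powerIndicator γ q) * ξ q * chain (transposeᶠ f) N (complement N Ds)
        ≈⟨ *-cong (reflexive (cong (λ Ds → ∏ (Vec.zipWith powerIndicator γ Ds) * ξ Ds)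
             (complement-involutive Ds∣N)))
                  (chain-transpose f Ds∣N) ⟩
      ∏ (Vec.zipWith powerIndicator γ Ds) * ξ Ds * (fromℕs (Vec.map (N ÷_) Ds) * chain f N Ds)
        ≈⟨ trans (*.x∙yz≈y∙xz _ _ _) (*-congˡ (*-assoc _ _ _)) ⟩
      fromℕs (Vec.map (N ÷_) Ds) * weight γ ξ f Ds ∎
      where
      q = complement N (complement N Ds)

    -- Substituting complements for the summation tuples undoes all reversals: the tuple, f and `ls`
    -- are each reversed once, and products ignore the order.
    fourierCoeff-transform : ∀ ls → fourierCoeff γ ξ f N ls ≈
                             transform (divisors N) (codivisibilityKernel N) (weight γ ξ f) ls
    fourierCoeff-transform ls = begin
      (1/ N) ^ᶜ m * S₁ (transposeʷ γ ξ N) (transposeᶠ f) N (Vec.reverse ls)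
        ≈⟨ *-congˡ (trans (S-transform (Vec.replicate m 1) (replicate-nonZero m) (transposeʷ γ ξ N)
             (transposeᶠ f) (Vec.reverse ls))
             (sym (∑-complement-tuples m _))) ⟩
      (1/ N) ^ᶜ m * ∑ (tuples m (divisors N)) (λ Ds →
        W (complement N Ds) * K (Vec.reverse ls) (complement N Ds))
        ≈⟨ *-∑ (tuples m (divisors N)) _ ⟩
      ∑ (tuples m (divisors N)) (λ Ds →
        (1/ N) ^ᶜ m * (W (complement N Ds) * K (Vec.reverse ls) (complement N Ds)))
        ≈⟨ ∑-cong (tuples m (divisors N)) (λ {Ds} Ds∈ → term (∈-tuples-divisors⁻ m Ds∈)) ⟩
      transform (divisors N) (codivisibilityKernel N) (weight γ ξ f) ls ∎
      where
      W = weight (Vec.replicate m 1) (transposeʷ γ ξ N) (transposeᶠ f)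
      K : Vec ℕ m → Vec ℕ m → Carrier
      K ns Ds = ∏ (Vec.zipWith (divisibilityKernel N) ns Ds)
      K-reverse : ∀ Ds → K (Vec.reverse ls) (complement N Ds) ≈ K ls (Vec.map (N ÷_) Ds)
      K-reverse Ds = trans (reflexive (cong ∏ (≡.trans
        (cong (Vec.zipWith (divisibilityKernel N) (Vec.reverse ls)) (Vec.map-reverse (N ÷_) Ds))
        (zipWith-reverse (divisibilityKernel N) ls (Vec.map (N ÷_) Ds)))))
        (∏-reverse (Vec.zipWith (divisibilityKernel N) ls (Vec.map (N ÷_) Ds)))
      term : ∀ {Ds} → All (_∣ N) Ds →
             (1/ N) ^ᶜ m * (W (complement N Ds) * K (Vec.reverse ls) (complement N Ds)) ≈
             weight γ ξ f Ds * ∏ (Vec.zipWith (codivisibilityKernel N) ls Ds)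
      term {Ds} Ds∣N = begin
        (1/ N) ^ᶜ m * (W (complement N Ds) * K (Vec.reverse ls) (complement N Ds))
          ≈⟨ *-congˡ (*-cong (weight-transpose Ds∣N) (K-reverse Ds)) ⟩
        (1/ N) ^ᶜ m * (fromℕs (Vec.map (N ÷_) Ds) * weight γ ξ f Ds * K ls (Vec.map (N ÷_) Ds))
          ≈⟨ trans (*-congˡ (*.xy∙z≈y∙xz _ _ _)) (*.x∙yz≈y∙xz _ _ _) ⟩
        weight γ ξ f Ds * ((1/ N) ^ᶜ m * (fromℕs (Vec.map (N ÷_) Ds) * K ls (Vec.map (N ÷_) Ds)))
          ≈⟨ *-congˡ (∏-codivisibility ls Ds) ⟨
        weight γ ξ f Ds * ∏ (Vec.zipWith (codivisibilityKernel N) ls Ds) ∎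

    -- α at d is a at N/d, so the kernel is that of the Fourier coefficients with its first argument
    -- complemented.
    ramanujanCoeff-transform : ∀ ds → ramanujanCoeff γ ξ f N ds ≈
      transform (divisors N) (λ d D → codivisibilityKernel N (N ÷ d) D) (weight γ ξ f) ds
    ramanujanCoeff-transform ds = begin
      ramanujanCoeff γ ξ f N ds
        ≈⟨ reflexive (cong (λ ns → (1/ N) ^ᶜ m * S₁ (transposeʷ γ ξ N) (transposeᶠ f) N ns)
             (Vec.map-reverse (N ÷_) ds)) ⟩
      fourierCoeff γ ξ f N (Vec.map (N ÷_) ds)
        ≈⟨ fourierCoeff-transform (Vec.map (N ÷_) ds) ⟩
      transform (divisors N) (codivisibilityKernel N) (weight γ ξ f) (Vec.map (N ÷_) ds)
        ≈⟨ ∑-cong (tuples m (divisors N)) (λ {Ds} _ → *-congˡ (reflexive (cong ∏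
             (Vec.zipWith-map₁ (codivisibilityKernel N) (N ÷_) ds Ds)))) ⟩
      transform (divisors N) (λ d D → codivisibilityKernel N (N ÷ d) D) (weight γ ξ f) ds ∎

    ramanujanSum-transform : ∀ α ns → ramanujanSum N α ns ≈ transform (divisors N) ramanujanKernel α ns
    ramanujanSum-transform α ns = ∑-cong (tuples m (divisors N)) λ {ds} _ →
      *-congˡ (reflexive (cong ∏ (Vec.zipWith-comm (λ _ _ → ≡.refl) ds ns)))

    module _ (γ≢0 : All NonZero γ) where

      -- Both sides transform the same weight: the divisibility kernel factors as the Fourier kernel
      -- times the codivisibility kernel, and the latter applied to the weight is the coefficient. P
      -- is trivial because the factorisation holds for every n.
      S-fourierSum : ∀ ns → S γ ξ f N ns ≈ fourierSum N (fourierCoeff γ ξ f N) ns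
      S-fourierSum ns = begin
        S γ ξ f N ns
          ≈⟨ S-transform γ γ≢0 ξ f ns ⟩
        transform (divisors N) (divisibilityKernel N) (weight γ ξ f) ns
          ≈⟨ transform-∘ {P = λ _ → ⊤} (range⁺ N) (divisors N) _ _ _
               (λ _ D∈ → fourier-codivisibility N (∈-divisors⁻ D∈)) (weight γ ξ f) (All.universal _ ns) ⟨
        transform (range⁺ N) (fourierKernel N)
          (transform (divisors N) (codivisibilityKernel N) (weight γ ξ f)) ns
          ≈⟨ transform-cong (range⁺ N) (fourierKernel N) (λ {ls} _ → fourierCoeff-transform ls) ns ⟨
        fourierSum N (fourierCoeff γ ξ f N) ns ∎

      S-ramanujanSum : ∀ ns → S γ ξ f N ns ≈ ramanujanSum N (ramanujanCoeff γ ξ f N) ns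
      S-ramanujanSum ns = begin
        S γ ξ f N ns
          ≈⟨ S-transform γ γ≢0 ξ f ns ⟩
        transform (divisors N) (divisibilityKernel N) (weight γ ξ f) ns
          ≈⟨ transform-∘ {P = λ _ → ⊤} (divisors N) (divisors N) _ _ _
               (λ _ D∈ → ramanujan-codivisibility (∈-divisors⁻ D∈)) (weight γ ξ f) (All.universal _ ns) ⟨
        transform (divisors N) ramanujanKernel
          (transform (divisors N) (λ d D → codivisibilityKernel N (N ÷ d) D) (weight γ ξ f)) ns
          ≈⟨ transform-cong (divisors N) ramanujanKernel (λ {ds} _ → ramanujanCoeff-transform ds) ns ⟨
        transform (divisors N) ramanujanKernel (ramanujanCoeff γ ξ f N) ns
          ≈⟨ ramanujanSum-transform (ramanujanCoeff γ ξ f N) ns ⟨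
        ramanujanSum N (ramanujanCoeff γ ξ f N) ns ∎

      fourierCoeff-unique : ∀ a → (∀ ns → All NonZero ns → S γ ξ f N ns ≈ fourierSum N a ns) →
        ∀ ls → All (λ l → 1 ≤ l × l ≤ N) ls → a ls ≈ fourierCoeff γ ξ f N ls
      fourierCoeff-unique a S≈a ls 1≤ls≤N = transform-injective
        (range⁺ N) (fourierKernel N) (inverseFourierKernel N)
        -- The sample points 1,...,N of the inverse kernel are positive, so the assumed expansion is
        -- available there.
        (range⁺-unique N) (proj₁ ∘ ∈-range⁻) (inverseFourier-fourier N)
        (λ {ns} ns≢0 → trans (sym (S≈a ns ns≢0)) (S-fourierSum ns))
        (All.map (λ { (1≤l , l≤N) → ∈-range⁺ {{ℕ.>-nonZero 1≤l}} l≤N }) 1≤ls≤N)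

      -- The samples n run over {1,...,N} while the coefficients are indexed by the divisors of N,
      -- so the kernel is in general not square; a left inverse still gives injectivity.
      ramanujanCoeff-unique : ∀ α → (∀ ns → All NonZero ns → S γ ξ f N ns ≈ ramanujanSum N α ns) →
        ∀ ds → All (_∣ N) ds → α ds ≈ ramanujanCoeff γ ξ f N ds
      ramanujanCoeff-unique α S≈α ds ds∣N = transform-injective
        (range⁺ N) ramanujanKernel inverseRamanujanKernel
        (divisors-unique N) (proj₁ ∘ ∈-range⁻) inverseRamanujan-ramanujan
        (λ {ns} ns≢0 → trans (sym (ramanujanSum-transform α ns)) (trans (sym (S≈α ns ns≢0))
          (trans (S-ramanujanSum ns) (ramanujanSum-transform (ramanujanCoeff γ ξ f N) ns))))
        (All.map ∈-divisors⁺ ds∣N)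

theorem2p7 : ∀ {c ℓ₁ ℓ₂} (ℂ : ComplexExponentialField c ℓ₁ ℓ₂) → let open Arithmetic ℂ in
    (m : ℕ) .{{_ : NonZero m}} (γ : Vec ℕ m) → All NonZero γ →
    (f : Vec ArithmeticFunction (suc m)) (ξ : Vec ℕ m → Carrier) →
    (n₁ : ℕ) .{{_ : NonZero n₁}} →
    (∀ (ns : Vec ℕ m) → All NonZero ns →
    (S γ ξ f n₁ ns ≈ fourierSum n₁ (fourierCoeff γ ξ f n₁) ns) ×
    (fourierSum n₁ (fourierCoeff γ ξ f n₁) ns ≈ ramanujanSum n₁ (ramanujanCoeff γ ξ f n₁) ns)) ×
    (∀ (a : Vec ℕ m → Carrier) →
    (∀ (ns : Vec ℕ m) → All NonZero ns → S γ ξ f n₁ ns ≈ fourierSum n₁ a ns) →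
    ∀ (ls : Vec ℕ m) → All (λ l → 1 ≤ l × l ≤ n₁) ls → a ls ≈ fourierCoeff γ ξ f n₁ ls) ×
    (∀ (α : Vec ℕ m → Carrier) →
    (∀ (ns : Vec ℕ m) → All NonZero ns → S γ ξ f n₁ ns ≈ ramanujanSum n₁ α ns) →
    ∀ (ds : Vec ℕ m) → All (_∣ n₁) ds → α ds ≈ ramanujanCoeff γ ξ f n₁ ds)
theorem2p7 ℂ m γ γ≢0 f ξ n₁ =
  (λ ns _ → S-fourierSum γ ξ f γ≢0 ns ,
            trans (sym (S-fourierSum γ ξ f γ≢0 ns)) (S-ramanujanSum γ ξ f γ≢0 ns)) ,
  fourierCoeff-unique γ ξ f γ≢0 ,
  ramanujanCoeff-unique γ ξ f γ≢0
  where
  open Arithmetic ℂ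
  open Coefficients ℂ n₁
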